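{- Let $G$ be a finite directed graph such that the undirected graph $\nabla G$ contains a cycle. Then the stable composite state problem ("given a CFSM protocol $\mathbf P$ with communication graph $G$ and a composite state $S$ of $\mathbf P$, is $S$ stable?") is algorithmically undecidable for CFSM protocols with communication graph $G$.
   Context: For a directed graph $G$, $\nabla G$ denotes the corresponding undirected (multi)graph obtained by forgetting edge orientations (parallel edges are kept, so e.g. two opposite edges between the same two nodes form a cycle). A CFSM protocol $\mathbf P$ with communication graph $G=(N,E)$ (each edge $\xi$ has tail $-\xi$ and head $+\xi$) consists of pairwise disjoint finite message sets $M_\xi$, $\xi\in E$, and for each $j\in N$ a finite state machine $F_j=(K_j,\Sigma_j,T_j,h_j)$ with finite state set $K_j$, initial state $h_j$, alphabet $\Sigma_j=\{+b: b\in M_\xi,\ j=+\xi\}\cup\{ -b: b\in M_\xi,\ j=-\xi\}$ and transitions $T_j\subseteq K_j\times\Sigma_j\times K_j$ ($+b$ = receive, $-b$ = send). A composite state is $S=(p_j:j\in N)$, $p_j\in K_j$; a channel content is $C=(x_\xi:\xi\in E)$, $x_\xi\in M_\xi^*$; global states are pairs $(S,C)$; $C^0$ has all components empty and the initial global state is $((h_j:j\in N),C^0)$. A step: some machine $F_i$ takes a transition $p_i\xrightarrow{ -b}q_i$ with $b\in M_\beta$, $i=-\beta$, and $b$ is appended to the end of $x_\beta$; or takes $p_i\xrightarrow{+b}q_i$ with $b\in M_\beta$, $i=+\beta$, where $x_\beta$ begins with $b$ and this first symbol is removed; all other machine states and channels are unchanged. A composite state $S$ is stable if the global state $(S,C^0)$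 is reachable from the initial global state by finitely many steps. -}

module Defs where

open import Data.Nat using (ℕ; suc; _*_; _^_; _<_)
open import Data.Fin using (Fin; toℕ; fromℕ; inject₁) renaming (zero to fzero; suc to fsuc)
open import Data.List using (List; []; _∷_; [_]; _++_; map; tabulate)
open import Data.List.Membership.Propositional using (_∈_)
open import Data.Vec using (Vec; []; _∷_; lookup)
open import Data.Vec.Relation.Binary.Pointwise.Inductive using (Pointwise)
open import Data.Product using (Σ; Σ-syntax; ∃-syntax; _×_; _,_)
open import Data.Sum using (_⊎_; swap)
open import Function.Definitions using (Injective)
open import Relation.Nullary using (¬_)
open import Relation.Binary.PropositionalEquality using (_≡_; _≢_)
open import Relation.Binary.Construct.Closure.ReflexiveTransitive using (Star)

data Rec : ℕ → Set where
  zeroᵣ : ∀ {n} → Rec n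
  sucᵣ  : Rec 1
  proj  : ∀ {n} → Fin n → Rec n
  comp  : ∀ {m n} → Rec m → Vec (Rec n) m → Rec n
  prec  : ∀ {n} → Rec n → Rec (suc (suc n)) → Rec (suc n)
  mu    : ∀ {n} → Rec (suc n) → Rec n

infix 4 _[_]⇓_

-- f [ xs ]⇓ y : the partial function f is defined at xs, with value y.
data _[_]⇓_ : ∀ {n} → Rec n → Vec ℕ n → ℕ → Set where
  zero⇓ : ∀ {n} {xs : Vec ℕ n} → zeroᵣ [ xs ]⇓ 0
  suc⇓  : ∀ {x} → sucᵣ [ x ∷ [] ]⇓ suc x
  proj⇓ : ∀ {n} {xs : Vec ℕ n} (i : Fin n) → proj i [ xs ]⇓ lookup xs i
  comp⇓ : ∀ {m n} {f : Rec m} {gs : Vec (Rec n) m} {xs ys z} →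
          Pointwise (λ g y → g [ xs ]⇓ y) gs ys →
          f [ ys ]⇓ z →
          comp f gs [ xs ]⇓ z
  prec-zero⇓ : ∀ {n} {f : Rec n} {g xs z} →
               f [ xs ]⇓ z →
               prec f g [ 0 ∷ xs ]⇓ z
  prec-suc⇓  : ∀ {n} {f : Rec n} {g xs k r z} →
               prec f g [ k ∷ xs ]⇓ r →
               g [ k ∷ r ∷ xs ]⇓ z →
               prec f g [ suc k ∷ xs ]⇓ z
  mu⇓ : ∀ {n} {f : Rec (suc n)} {xs y} →
        (∀ z → z < y → ∃[ w ] (f [ z ∷ xs ]⇓ suc w)) →
        f [ y ∷ xs ]⇓ 0 →
        mu f [ xs ]⇓ y

record DecisionProblem : Set₁ where
  field
    Instance : Set
    code     : Instance → ℕ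
    Yes      : Instance → Set

AlgorithmicallyDecidable : DecisionProblem → Set
AlgorithmicallyDecidable D =
  Σ[ f ∈ Rec 1 ] (∀ x → (Yes x × f [ code x ∷ [] ]⇓ 1) ⊎ (¬ Yes x × f [ code x ∷ [] ]⇓ 0))
  where open DecisionProblem D

AlgorithmicallyUndecidable : DecisionProblem → Set
AlgorithmicallyUndecidable D = ¬ AlgorithmicallyDecidable D

-- Gödel numbering: ⟨_,_⟩ is a bijection from ℕ × ℕ onto the positive
-- integers, hence codeList is a bijection from List ℕ onto ℕ.

⟨_,_⟩ : ℕ → ℕ → ℕ
⟨ a , b ⟩ = 2 ^ a * suc (2 * b)

codeList : List ℕ → ℕ
codeList []       = 0
codeList (x ∷ xs) = ⟨ x , codeList xs ⟩

-- Parallel edges and loops are allowed.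
record DiGraph : Set where
  field
    #nodes #edges : ℕ

  Node = Fin #nodes
  Edge = Fin #edges

  field
    tail head : Edge → Node

record Multigraph : Set₁ where
  field
    #nodes #edges : ℕ

  Node = Fin #nodes
  Edge = Fin #edges

  field
    Joins     : Edge → Node → Node → Set
    symmetric : ∀ {e u v} → Joins e u v → Joins e v u

∇ : DiGraph → Multigraph
∇ G = record
  { #nodes    = #nodes
  ; #edges    = #edges
  ; Joins     = λ ξ u v → (tail ξ ≡ u × head ξ ≡ v) ⊎ (tail ξ ≡ v × head ξ ≡ u)
  ; symmetric = swap
  }
  where open DiGraph G

-- A cycle v₀ e₀ v₁ e₁ … eₗ₋₁ vₗ = v₀ of length l ≥ 1, in which v₀ … vₗ₋₁ are
-- distinct and e₀ … eₗ₋₁ are distinct.  A loop is a cycle of length 1, two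
-- parallel edges form a cycle of length 2.
record Cycle (H : Multigraph) : Set where
  open Multigraph H
  field
    length         : ℕ
    positive       : 0 < length
    node           : Fin (suc length) → Node
    edge           : Fin length → Edge
    joins          : ∀ i → Joins (edge i) (node (inject₁ i)) (node (fsuc i))
    closed         : node (fromℕ length) ≡ node fzero
    distinct-nodes : Injective _≡_ _≡_ (λ i → node (inject₁ i))
    distinct-edges : Injective _≡_ _≡_ edge

module _ (G : DiGraph) where
  open DiGraph G

  -- The message set of ξ is Fin (#msgs ξ); messages always occur together
  -- with their edge, so that the message sets of distinct edges are disjoint.
  data Action (#msgs : Edge → ℕ) (j : Node) : Set where
    send : (ξ : Edge) → j ≡ tail ξ → Fin (#msgs ξ) → Action #msgs j
    recv : (ξ : Edge) → j ≡ head ξ → Fin (#msgs ξ) → Action #msgs j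

  record FSM (#msgs : Edge → ℕ) (j : Node) : Set where
    field
      #states     : ℕ
      transitions : List (Fin #states × Action #msgs j × Fin #states)
      initial     : Fin #states

  record Protocol : Set where
    field
      #msgs   : Edge → ℕ
      machine : (j : Node) → FSM #msgs j

module _ {G : DiGraph} (P : Protocol G) where
  open DiGraph G
  open Protocol P
  open module M (j : Node) = FSM (machine j) using (#states; transitions; initial)

  CompositeState : Set
  CompositeState = (j : Node) → Fin (#states j)

  ChannelContent : Set
  ChannelContent = (ξ : Edge) → List (Fin (#msgs ξ))

  GlobalState : Set
  GlobalState = CompositeState × ChannelContent

  C⁰ : ChannelContent
  C⁰ ξ = []

  initialGlobal : GlobalState
  initialGlobal = initial , C⁰

  data Step : GlobalState → GlobalState → Set where
    send-step : ∀ {S C S′ C′} (i : Node) (β : Edge) (i≡ : i ≡ tail β) (b : Fin (#msgs β)) →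
                (S i , send β i≡ b , S′ i) ∈ transitions i →
                C′ β ≡ C β ++ [ b ] →
                (∀ j → j ≢ i → S′ j ≡ S j) →
                (∀ ξ → ξ ≢ β → C′ ξ ≡ C ξ) →
                Step (S , C) (S′ , C′)
    recv-step : ∀ {S C S′ C′} (i : Node) (β : Edge) (i≡ : i ≡ head β) (b : Fin (#msgs β)) →
                (S i , recv β i≡ b , S′ i) ∈ transitions i →
                C β ≡ b ∷ C′ β →
                (∀ j → j ≢ i → S′ j ≡ S j) →
                (∀ ξ → ξ ≢ β → C′ ξ ≡ C ξ) →
                Step (S , C) (S′ , C′)

  -- Families indexed by nodes or edges are functions, so two global states
  -- are the same when they agree pointwise.
  _≈_ : GlobalState → GlobalState → Set
  (S , C) ≈ (S′ , C′) = (∀ j → S j ≡ S′ j) × (∀ ξ → C ξ ≡ C′ ξ)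

  Reachable : GlobalState → Set
  Reachable g = ∃[ g′ ] (Star Step initialGlobal g′ × g′ ≈ g)

  Stable : CompositeState → Set
  Stable S = Reachable (S , C⁰)

module _ {G : DiGraph} where
  open DiGraph G

  codeAction : ∀ {#msgs j} → Action G #msgs j → ℕ
  codeAction (send ξ _ b) = codeList (0 ∷ toℕ ξ ∷ toℕ b ∷ [])
  codeAction (recv ξ _ b) = codeList (1 ∷ toℕ ξ ∷ toℕ b ∷ [])

  codeFSM : ∀ {#msgs j} → FSM G #msgs j → ℕ
  codeFSM F = codeList (#states ∷ codeList (map codeTransition transitions) ∷ toℕ initial ∷ [])
    where
    open FSM F
    codeTransition : Fin #states × Action G _ _ × Fin #states → ℕ
    codeTransition (p , a , q) = codeList (toℕ p ∷ codeAction a ∷ toℕ q ∷ [])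

  codeProtocol : Protocol G → ℕ
  codeProtocol P = codeList (codeList (tabulate #msgs) ∷ codeList (tabulate (λ j → codeFSM (machine j))) ∷ [])
    where open Protocol P

  codeCompositeState : (P : Protocol G) → CompositeState P → ℕ
  codeCompositeState P S = codeList (tabulate (λ j → toℕ (S j)))

StableCompositeStateProblem : DiGraph → DecisionProblem
StableCompositeStateProblem G = record
  { Instance = Σ (Protocol G) CompositeState
  ; code     = λ (P , S) → codeList (codeProtocol P ∷ codeCompositeState P S ∷ [])
  ; Yes      = λ (P , S) → Stable P S
  }

{-# OPTIONS --safe #-}
module Submission where

-- A recursive function is compiled to a deterministic machine with one FIFO
-- queue.  The machine is placed at a node v₀ of the cycle and the other nodes of
-- the cycle become relays that repeat on one of their two cycle edges each symbol
-- of the other, whatever the orientations.  If all channels are empty at the end,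
-- the words at the two ends of every edge agree, hence so do the words that v₀
-- put on and got from the cycle.  When an edge of v₀ has the wrong orientation,
-- v₀ may get a symbol before putting it, but a deterministic machine whose actual
-- run never reads from an empty queue gains nothing from this.
--
-- The machine starts by writing a number m into the queue.  If f decided
-- stability, take the machine that evaluates f at the code of the instance and
-- accepts on the value 0, and let m be the code of its own transition table
-- without the part that writes m.  From m alone the code of the whole
-- instance is computable, so the machine can contradict f on its own instance.

open import Data.Bool using (Bool; true; false; if_then_else_)
open import Data.Empty using (⊥; ⊥-elim)
open import Data.Fin using (Fin; zero; suc; toℕ; fromℕ; inject₁; _≟_; _↑ˡ_)
import Data.Fin.Properties as Fin
open import Data.Fin.Properties using (↑ˡ-injective; 0≢1+n; any?; toℕ-injective; toℕ-fromℕ<)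
open import Data.List as List using (List; []; _∷_; [_]; _++_; length; map; concatMap; allFin; tabulate)
open import Data.List.Properties using (++-assoc; ++-identityʳ; ∷-injectiveˡ; ∷-injectiveʳ; map-∘; tabulate-cong)
open import Data.List.Membership.Propositional using (_∈_; lose; find)
open import Data.List.Membership.Propositional.Properties using (∈-map⁺; ∈-map⁻; ∈-++⁺ˡ; ∈-++⁺ʳ; ∈-++⁻; ∈-concatMap⁺; ∈-concatMap⁻; ∈-allFin)
open import Data.List.Relation.Unary.Any using (here; there; index)
open import Data.List.Relation.Unary.Any.Properties using (lookup-index)
open import Data.Maybe using (Maybe; just; nothing)
open import Data.Nat using (ℕ; zero; suc; _+_; _*_; _^_; _<_; _≤_; s≤s; z≤n)
open import Data.Nat.DivMod using (_mod_; m<n⇒m%n≡m; m%n<n)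
open import Data.Nat.Properties using (suc-injective; even≢odd; +-suc; +-identityʳ; +-monoˡ-≤; *-cancelˡ-≡; *-monoʳ-≤; ≤-refl; ≤-reflexive; ≤-trans; <-trans; n≤1+n; m≤n⇒m≤1+n; m≤n⇒m<n∨m≡n; m≤n+m; m≤m*n; m≤n*m; m^n>0; m^n≢0)
open import Data.Product using (Σ; Σ-syntax; ∃-syntax; _×_; _,_; proj₁; proj₂)
open import Data.Sum using (_⊎_; inj₁; inj₂; swap)
open import Data.Unit using (⊤; tt)
open import Data.Vec as Vec using (Vec; []; _∷_; lookup)
open import Data.Vec.Functional using (updateAt)
open import Data.Vec.Functional.Properties using (updateAt-updates; updateAt-minimal)
open import Data.Vec.Relation.Binary.Pointwise.Inductive as Pointwise using (Pointwise; []; _∷_)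
open import Function using (_∘_; const)
open import Function.Definitions using (Injective)
open import Relation.Binary.Construct.Closure.ReflexiveTransitive using (Star; ε; _◅_; _◅◅_)
open import Relation.Binary.PropositionalEquality using (_≡_; _≢_; refl; sym; trans; cong; cong₂; subst; subst₂; ≢-sym)
open import Relation.Nullary using (¬_; yes; no)

open import Defs

-- Queue programs for recursive functions

Sym : Set
Sym = Fin 3

pattern one = zero
pattern sep = suc zero
pattern end = suc (suc zero)

Word : Set
Word = List Sym

infixr 6 _⨾_
infix 4 _⊢_⇒_

-- loop a f back: run a, remove the first symbol x of the queue, run f x, and
-- start again if back x is true.
data Cmd : Set where
  skip : Cmd
  wr   : Sym → Cmd
  _⨾_  : Cmd → Cmd → Cmd
  loop : Cmd → (Sym → Cmd) → (Sym → Bool) → Cmd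

data _⊢_⇒_ : Cmd → Word → Word → Set where
  skip⇒ : ∀ {w} → skip ⊢ w ⇒ w
  wr⇒   : ∀ {a w} → wr a ⊢ w ⇒ w ++ [ a ]
  seq⇒  : ∀ {a b w w′ w″} → a ⊢ w ⇒ w′ → b ⊢ w′ ⇒ w″ → a ⨾ b ⊢ w ⇒ w″
  back⇒ : ∀ {a f back x w w′ w″ w‴} → back x ≡ true →
          a ⊢ w ⇒ x ∷ w′ → f x ⊢ w′ ⇒ w″ → loop a f back ⊢ w″ ⇒ w‴ →
          loop a f back ⊢ w ⇒ w‴
  exit⇒ : ∀ {a f back x w w′ w″} → back x ≡ false →
          a ⊢ w ⇒ x ∷ w′ → f x ⊢ w′ ⇒ w″ →
          loop a f back ⊢ w ⇒ w″

isOne notEnd : Sym → Bool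
isOne one = true
isOne sep = false
isOne end = false
notEnd one = true
notEnd sep = true
notEnd end = false

num : ℕ → Word
num zero    = [ sep ]
num (suc x) = one ∷ num x

enc : List ℕ → Word
enc []       = []
enc (x ∷ xs) = num x ++ enc xs

-- A program sees only the front of the queue, so every operation works by rotation; the marker
-- `end` shows where the stored list stops.
queue : List ℕ → Word
queue s = enc s ++ [ end ]

enc-++ : ∀ xs ys → enc (xs ++ ys) ≡ enc xs ++ enc ys
enc-++ []       ys = refl
enc-++ (x ∷ xs) ys = trans (cong (num x ++_) (enc-++ xs ys)) (sym (++-assoc (num x) (enc xs) (enc ys)))

copyNum dropNum copyRest : Cmd
copyNum  = loop skip wr isOne
dropNum  = loop skip (λ _ → skip) isOne
copyRest = loop skip wr notEnd

copyNum⇒ : ∀ x w → copyNum ⊢ num x ++ w ⇒ w ++ num x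
copyNum⇒ zero    w = exit⇒ refl skip⇒ wr⇒
copyNum⇒ (suc x) w =
  subst (copyNum ⊢ one ∷ num x ++ w ⇒_) (++-assoc w [ one ] (num x))
    (back⇒ refl skip⇒ wr⇒
      (subst (copyNum ⊢_⇒ (w ++ [ one ]) ++ num x) (sym (++-assoc (num x) w [ one ]))
        (copyNum⇒ x (w ++ [ one ]))))

dropNum⇒ : ∀ x w → dropNum ⊢ num x ++ w ⇒ w
dropNum⇒ zero    w = exit⇒ refl skip⇒ skip⇒
dropNum⇒ (suc x) w = back⇒ refl skip⇒ skip⇒ (dropNum⇒ x w)

-- `copyRest` does not stop at `sep`, so a numeral is passed in the middle of one loop. The rest of
-- that loop is the given derivation, hence the continuation form.
copyRest⇒-num : ∀ x v w {u} → copyRest ⊢ v ++ end ∷ w ++ num x ⇒ u → copyRest ⊢ num x ++ v ++ end ∷ w ⇒ u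
copyRest⇒-num zero    v w d = back⇒ refl skip⇒ wr⇒ (subst (copyRest ⊢_⇒ _) (sym (++-assoc v (end ∷ w) [ sep ])) d)
copyRest⇒-num (suc x) v w d = back⇒ refl skip⇒ wr⇒
  (subst (copyRest ⊢_⇒ _)
    (sym (trans (++-assoc (num x) (v ++ end ∷ w) [ one ]) (cong (num x ++_) (++-assoc v (end ∷ w) [ one ]))))
    (copyRest⇒-num x v (w ++ [ one ])
      (subst (λ t → copyRest ⊢ v ++ end ∷ t ⇒ _) (sym (++-assoc w [ one ] (num x))) d)))

copyRest⇒ : ∀ xs w → copyRest ⊢ enc xs ++ end ∷ w ⇒ (w ++ enc xs) ++ [ end ]
copyRest⇒ []       w rewrite ++-identityʳ w = exit⇒ refl skip⇒ wr⇒
copyRest⇒ (x ∷ xs) w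
  rewrite ++-assoc (num x) (enc xs) (end ∷ w) | sym (++-assoc w (num x) (enc xs)) =
  copyRest⇒-num x (enc xs) w (copyRest⇒ xs (w ++ num x))

copyNums : ℕ → Cmd
copyNums zero    = skip
copyNums (suc i) = copyNum ⨾ copyNums i

copyNums⇒ : ∀ xs v → copyNums (length xs) ⊢ enc xs ++ v ⇒ v ++ enc xs
copyNums⇒ []       v rewrite ++-identityʳ v = skip⇒
copyNums⇒ (x ∷ xs) v
  rewrite ++-assoc (num x) (enc xs) v | sym (++-assoc v (num x) (enc xs)) =
  seq⇒ (copyNum⇒ x (enc xs ++ v)) (subst (λ t → copyNums (length xs) ⊢ t ⇒ (v ++ num x) ++ enc xs)
    (sym (++-assoc (enc xs) v (num x))) (copyNums⇒ xs (v ++ num x)))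

-- Common first phase of the operations on entry `length pre`: the entry comes to the front, is
-- changed there or at the back, and `copyRest` finishes the rotation.
seek⇒ : ∀ pre xs → copyNums (length pre) ⊢ queue (pre ++ xs) ⇒ enc xs ++ end ∷ enc pre
seek⇒ pre xs = subst₂ (copyNums (length pre) ⊢_⇒_)
  (trans (sym (++-assoc (enc pre) (enc xs) [ end ])) (cong (_++ [ end ]) (sym (enc-++ pre xs))))
  (++-assoc (enc xs) [ end ] (enc pre))
  (copyNums⇒ pre (queue xs))

return⇒ : ∀ pre xs → copyRest ⊢ enc xs ++ end ∷ enc pre ⇒ queue (pre ++ xs)
return⇒ pre xs = subst (copyRest ⊢ enc xs ++ end ∷ enc pre ⇒_) (cong (_++ [ end ]) (sym (enc-++ pre xs)))
  (copyRest⇒ xs (enc pre))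

push : Cmd
push = wr sep ⨾ copyRest

-- After `copyNums i` the back of the queue is the place to which entry `i` will be recopied, so a
-- `one` written there becomes its additional leading `one`.
inc remove : ℕ → Cmd
inc i    = copyNums i ⨾ wr one ⨾ copyRest
remove i = copyNums i ⨾ dropNum ⨾ copyRest

-- The test is destructive: the `one` that it takes from entry `i` is the decrement that precedes
-- `b`, whereas the `sep` of a zero entry is written back. An existing entry never begins with
-- `end`, so that branch is only a default.
while : ℕ → Cmd → Cmd
while i b = loop (copyNums i) branch isOne
  module While where
  branch : Sym → Cmd
  branch one = copyRest ⨾ b
  branch sep = wr sep ⨾ copyRest
  branch end = skip

infix 4 _⊩_⇝_
infixr 6 _⨟_

record _⊩_⇝_ (c : Cmd) (s s′ : List ℕ) : Set where
  constructor onQueue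
  field exec : c ⊢ queue s ⇒ queue s′

_⨟_ : ∀ {a b s s′ s″} → a ⊩ s ⇝ s′ → b ⊩ s′ ⇝ s″ → a ⨾ b ⊩ s ⇝ s″
onQueue d ⨟ onQueue e = onQueue (seq⇒ d e)

push⇝ : ∀ s → push ⊩ s ⇝ 0 ∷ s
push⇝ s = onQueue (seq⇒ wr⇒
  (subst (copyRest ⊢_⇒ queue (0 ∷ s)) (sym (++-assoc (enc s) [ end ] [ sep ])) (copyRest⇒ s [ sep ])))

inc⇝ : ∀ pre x post → inc (length pre) ⊩ pre ++ x ∷ post ⇝ pre ++ suc x ∷ post
inc⇝ pre x post = onQueue (seq⇒ (seek⇒ pre (x ∷ post)) (seq⇒ wr⇒
  (subst₂ (copyRest ⊢_⇒_) (sym (++-assoc (enc (x ∷ post)) (end ∷ enc pre) [ one ]))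
    (cong (_++ [ end ]) (trans (++-assoc (enc pre) [ one ] (enc (x ∷ post))) (sym (enc-++ pre (suc x ∷ post)))))
    (copyRest⇒ (x ∷ post) (enc pre ++ [ one ])))))

remove⇝ : ∀ pre x post → remove (length pre) ⊩ pre ++ x ∷ post ⇝ pre ++ post
remove⇝ pre x post = onQueue (seq⇒ (seek⇒ pre (x ∷ post)) (seq⇒
  (subst (dropNum ⊢_⇒ enc post ++ end ∷ enc pre) (sym (++-assoc (num x) (enc post) (end ∷ enc pre)))
    (dropNum⇒ x (enc post ++ end ∷ enc pre)))
  (return⇒ pre post)))

while-exit⇝ : ∀ {b} pre post → while (length pre) b ⊩ pre ++ 0 ∷ post ⇝ pre ++ 0 ∷ post
while-exit⇝ pre post = onQueue (exit⇒ refl (seek⇒ pre (0 ∷ post)) (seq⇒ wr⇒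
  (subst₂ (copyRest ⊢_⇒_) (sym (++-assoc (enc post) (end ∷ enc pre) [ sep ]))
    (cong (_++ [ end ]) (trans (++-assoc (enc pre) [ sep ] (enc post)) (sym (enc-++ pre (0 ∷ post)))))
    (copyRest⇒ post (enc pre ++ [ sep ])))))

while-step⇝ : ∀ {b s s′} pre x post → b ⊩ pre ++ x ∷ post ⇝ s → while (length pre) b ⊩ s ⇝ s′ →
              while (length pre) b ⊩ pre ++ suc x ∷ post ⇝ s′
while-step⇝ pre x post (onQueue d) (onQueue e) =
  onQueue (back⇒ refl (seek⇒ pre (suc x ∷ post)) (seq⇒ (return⇒ pre (x ∷ post)) d) e)

data At : ℕ → List ℕ → ℕ → Set where
  here  : ∀ {x s} → At 0 (x ∷ s) x
  there : ∀ {i y x s} → At i s x → At (suc i) (y ∷ s) x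

at-split : ∀ {i s x} → At i s x → ∃[ pre ] ∃[ post ] (length pre ≡ i × pre ++ x ∷ post ≡ s)
at-split here = [] , _ , refl , refl
at-split (there {y = y} p) with at-split p
... | pre , post , refl , refl = y ∷ pre , post , refl , refl

-- An entry can be read only by counting it down, so it is unloaded into two fresh counters and then
-- restored from one of them.
dup : ℕ → Cmd
dup i = push ⨾ push ⨾ while (2 + i) (inc 0 ⨾ inc 1) ⨾ while 0 (inc (2 + i)) ⨾ remove 0

dup⇝ : ∀ {i s x} → At i s x → dup i ⊩ s ⇝ x ∷ s
dup⇝ {x = x} p with at-split p
... | pre , post , refl , refl =
  push⇝ _ ⨟ push⇝ _ ⨟
  subst (λ t → while (2 + length pre) (inc 0 ⨾ inc 1) ⊩ 0 ∷ 0 ∷ pre ++ x ∷ post ⇝ t ∷ t ∷ pre ++ 0 ∷ post)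
    (+-identityʳ x) (unload x 0 0) ⨟
  subst (λ t → while 0 (inc (2 + length pre)) ⊩ x ∷ x ∷ pre ++ 0 ∷ post ⇝ 0 ∷ x ∷ pre ++ t ∷ post)
    (+-identityʳ x) (reload x 0) ⨟
  remove⇝ [] 0 _
  where
  unload : ∀ x a b → while (2 + length pre) (inc 0 ⨾ inc 1) ⊩ a ∷ b ∷ pre ++ x ∷ post ⇝
                     (x + a) ∷ (x + b) ∷ pre ++ 0 ∷ post
  unload zero    a b = while-exit⇝ (a ∷ b ∷ pre) post
  unload (suc x) a b =
    while-step⇝ (a ∷ b ∷ pre) x post (inc⇝ [] a _ ⨟ inc⇝ [ suc a ] b _)
      (subst₂ (λ t t′ → while (2 + length pre) (inc 0 ⨾ inc 1) ⊩ suc a ∷ suc b ∷ pre ++ x ∷ post ⇝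
                        t ∷ t′ ∷ pre ++ 0 ∷ post)
        (+-suc x a) (+-suc x b) (unload x (suc a) (suc b)))

  reload : ∀ {y} a x → while 0 (inc (2 + length pre)) ⊩ a ∷ y ∷ pre ++ x ∷ post ⇝
                       0 ∷ y ∷ pre ++ (a + x) ∷ post
  reload         zero    x = while-exit⇝ [] _
  reload {y = y} (suc a) x =
    while-step⇝ [] a _ (inc⇝ (a ∷ y ∷ pre) x post)
      (subst (λ t → while 0 (inc (2 + length pre)) ⊩ a ∷ y ∷ pre ++ suc x ∷ post ⇝
                    0 ∷ y ∷ pre ++ t ∷ post)
        (+-suc a x) (reload a (suc x)))

shift : ∀ {n} → ℕ → Vec ℕ n → Vec ℕ n
shift k = Vec.map (k +_)

positions : ∀ m → Vec ℕ m
positions zero    = []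
positions (suc m) = 0 ∷ shift 1 (positions m)

removeSeconds : ℕ → Cmd
removeSeconds zero    = skip
removeSeconds (suc m) = remove 1 ⨾ removeSeconds m

-- compile f ρ pushes the value of f at the arguments that ρ locates in the stack.
compile    : ∀ {n} → Rec n → Vec ℕ n → Cmd
compileAll : ∀ {m n} → Vec (Rec n) m → Vec ℕ n → Cmd

compile zeroᵣ ρ = push
compile sucᵣ (i ∷ []) = dup i ⨾ inc 0
compile (proj i) ρ = dup (lookup ρ i)
compile (comp {m} f gs) ρ = compileAll gs ρ ⨾ compile f (positions m) ⨾ removeSeconds m
compile (prec f g) (i ∷ ρ) =
  -- During the loop the top of the stack holds the value so far, the number of iterations done and
  -- the number remaining; `while 2` tests the last of these.
  dup i ⨾ push ⨾ compile f (shift 2 ρ) ⨾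
  while 2 (compile g (1 ∷ 0 ∷ shift 3 ρ) ⨾ remove 1 ⨾ inc 1) ⨾ remove 1 ⨾ remove 1
compile (mu f) ρ =
  -- Entry 0 is the value of `f` at the candidate in entry 1. Once that value is zero, it is dropped
  -- and the candidate is the result.
  push ⨾ compile f (0 ∷ shift 1 ρ) ⨾
  while 0 (remove 0 ⨾ inc 0 ⨾ compile f (0 ∷ shift 1 ρ)) ⨾ remove 0

compileAll []       ρ = skip
compileAll (_∷_ {n = m} g gs) ρ = compileAll gs ρ ⨾ compile g (shift m ρ)

Located : ∀ {n} → Vec ℕ n → List ℕ → Vec ℕ n → Set
Located ρ s xs = Pointwise (λ i x → At i s x) ρ xs

at-shift : ∀ {k i s x} (ys : Vec ℕ k) → At i s x → At (k + i) (Vec.toList ys ++ s) x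
at-shift []       p = p
at-shift (y ∷ ys) p = there (at-shift ys p)

located-shift : ∀ {k n s} {ρ xs : Vec ℕ n} (ys : Vec ℕ k) → Located ρ s xs → Located (shift k ρ) (Vec.toList ys ++ s) xs
located-shift ys []       = []
located-shift ys (p ∷ ps) = at-shift ys p ∷ located-shift ys ps

located-positions : ∀ {m s} (ys : Vec ℕ m) → Located (positions m) (Vec.toList ys ++ s) ys
located-positions []       = []
located-positions (y ∷ ys) = here ∷ located-shift (y ∷ []) (located-positions ys)

removeSeconds⇝ : ∀ {m z s} (ys : Vec ℕ m) → removeSeconds m ⊩ z ∷ Vec.toList ys ++ s ⇝ z ∷ s
removeSeconds⇝         []       = onQueue skip⇒
removeSeconds⇝ {z = z} (y ∷ ys) = remove⇝ [ z ] y _ ⨟ removeSeconds⇝ ys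

compile⇝    : ∀ {n} (f : Rec n) {ρ xs y s} → f [ xs ]⇓ y → Located ρ s xs →
              compile f ρ ⊩ s ⇝ y ∷ s
compileAll⇝ : ∀ {m n} (gs : Vec (Rec n) m) {ρ xs ys s} → Pointwise (λ g y → g [ xs ]⇓ y) gs ys → Located ρ s xs →
              compileAll gs ρ ⊩ s ⇝ Vec.toList ys ++ s

compile⇝ zeroᵣ zero⇓ ps = push⇝ _
compile⇝ sucᵣ suc⇓ (p ∷ []) = dup⇝ p ⨟ inc⇝ [] _ _
compile⇝ (proj i) (proj⇓ .i) ps = dup⇝ (Pointwise.lookup ps i)
compile⇝ (comp f gs) (comp⇓ {ys = ys} ds d) ps =
  compileAll⇝ gs ds ps ⨟ compile⇝ f d (located-positions ys) ⨟ removeSeconds⇝ ys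
-- The derivation has the last iteration outermost, while the loop performs the first one first.
-- `unroll` therefore turns a derivation into a map that prepends its iterations to any continuation
-- of the loop.
compile⇝ (prec f g) {i ∷ ρ} {k ∷ xs} {y} {s} d (p ∷ ps) with unroll d
  where
  body : Cmd
  body = compile g (1 ∷ 0 ∷ shift 3 ρ) ⨾ remove 1 ⨾ inc 1

  -- j is the number of iterations that remain.
  unroll : ∀ {k y} → prec f g [ k ∷ xs ]⇓ y →
           ∃[ r ] (f [ xs ]⇓ r × (∀ j {s′} → while 2 body ⊩ y ∷ k ∷ j ∷ s ⇝ s′ →
                                  while 2 body ⊩ r ∷ 0 ∷ (k + j) ∷ s ⇝ s′))
  unroll (prec-zero⇓ e) = _ , e , λ j l → l
  unroll (prec-suc⇓ {k = k} {r = r} e e′) with unroll e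
  ... | r₀ , e₀ , l₀ = r₀ , e₀ , λ j {s′} l →
    subst (λ t → while 2 body ⊩ r₀ ∷ 0 ∷ t ∷ s ⇝ s′) (+-suc k j)
      (l₀ (suc j) (while-step⇝ (r ∷ k ∷ []) j s
        (compile⇝ g e′ (there here ∷ here ∷ located-shift (r ∷ k ∷ j ∷ []) ps) ⨟
         remove⇝ [ _ ] r _ ⨟ inc⇝ [ _ ] k _) l))
... | r , e , l =
  dup⇝ p ⨟ push⇝ _ ⨟ compile⇝ f e (located-shift (0 ∷ k ∷ []) ps) ⨟
  subst (λ t → while 2 _ ⊩ r ∷ 0 ∷ t ∷ s ⇝ y ∷ k ∷ 0 ∷ s) (+-identityʳ k) (l 0 (while-exit⇝ (y ∷ k ∷ []) s)) ⨟
  remove⇝ [ y ] k _ ⨟ remove⇝ [ y ] 0 _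
compile⇝ (mu f) {ρ} {xs} {y} {s} (mu⇓ below d) ps =
  push⇝ s ⨟ proj₁ (proj₂ start) ⨟ proj₂ (proj₂ start) ⨟ remove⇝ [] 0 _
  where
  F next : Cmd
  F    = compile f (0 ∷ shift 1 ρ)
  next = remove 0 ⨾ inc 0 ⨾ F

  eval : ∀ {z w} → f [ z ∷ xs ]⇓ w → F ⊩ z ∷ s ⇝ w ∷ z ∷ s
  eval {z} e = compile⇝ f e (here ∷ located-shift (z ∷ []) ps)

  -- Recursion on the distance `j` from the candidate `z` to `y`. The evaluation at `z` is kept
  -- apart from the loop because each loop body ends with the evaluation at the next candidate.
  search : ∀ j z → j + z ≡ y →
           ∃[ w ] (F ⊩ z ∷ s ⇝ w ∷ z ∷ s × while 0 next ⊩ w ∷ z ∷ s ⇝ 0 ∷ y ∷ s)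
  search zero    z refl = 0 , eval d , while-exit⇝ [] (z ∷ s)
  search (suc j) z refl with search j (suc z) (+-suc j z) | below z (s≤s (m≤n+m z j))
  ... | _ , first , others | w , e = suc w , eval e ,
    while-step⇝ [] w (z ∷ s) (remove⇝ [] w (z ∷ s) ⨟ inc⇝ [] z s ⨟ first) others

  start = search y 0 (+-identityʳ y)

compileAll⇝ []       []       ps = onQueue skip⇒
compileAll⇝ (g ∷ gs) (_∷_ {ys = ys} d ds) ps = compileAll⇝ gs ds ps ⨟ compile⇝ g d (located-shift ys ps)

-- Deterministic queue machines

data Instr (X : Set) : Set where
  write : Sym → X → Instr X
  read  : (Sym → X) → Instr X
  halt  : Instr X

-- One state for each program point that writes or reads. In a `loop`, `inj₂ nothing` is the read,
-- and `inj₂ (just (x , s))` is a point of the branch for the symbol `x`.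
St : Cmd → Set
St skip            = ⊥
St (wr a)          = ⊤
St (a ⨾ b)         = St a ⊎ St b
St (loop a f back) = St a ⊎ Maybe (Σ[ x ∈ Sym ] St (f x))

module _ {X : Set} where

  -- emb places the states of the command among those of a larger machine,
  -- and e is the state in which control is handed over.
  entry : (c : Cmd) → (St c → X) → X → X
  entry skip            emb e = e
  entry (wr a)          emb e = emb tt
  entry (a ⨾ b)         emb e = entry a (emb ∘ inj₁) (entry b (emb ∘ inj₂) e)
  entry (loop a f back) emb e = entry a (emb ∘ inj₁) (emb (inj₂ nothing))

  after : ∀ a f back → (St (loop a f back) → X) → X → Sym → X
  after a f back emb e x = if back x then entry (loop a f back) emb e else e

  instr : (c : Cmd) → (St c → X) → X → St c → Instr X
  instr (wr a)          emb e tt                    = write a e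
  instr (a ⨾ b)         emb e (inj₁ s)              = instr a (emb ∘ inj₁) (entry b (emb ∘ inj₂) e) s
  instr (a ⨾ b)         emb e (inj₂ s)              = instr b (emb ∘ inj₂) e s
  instr (loop a f back) emb e (inj₁ s)              = instr a (emb ∘ inj₁) (emb (inj₂ nothing)) s
  instr (loop a f back) emb e (inj₂ nothing)        =
    read (λ x → entry (f x) (emb ∘ inj₂ ∘ just ∘ (x ,_)) (after a f back emb e x))
  instr (loop a f back) emb e (inj₂ (just (x , s))) =
    instr (f x) (emb ∘ inj₂ ∘ just ∘ (x ,_)) (after a f back emb e x) s

module _ {X : Set} (Δ : X → Instr X) where

  data Move : X × Word → X × Word → Set where
    write-move : ∀ {x a y w} → Δ x ≡ write a y → Move (x , w) (y , w ++ [ a ])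
    read-move  : ∀ {x g a w} → Δ x ≡ read g → Move (x , a ∷ w) (g a , w)

  -- Only the embedded states are required to carry the instructions of `c`, so the induction passes
  -- to subcommands inside the same large machine.
  run : ∀ c {emb e w w′} → (∀ s → Δ (emb s) ≡ instr c emb e s) → c ⊢ w ⇒ w′ → Star Move (entry c emb e , w) (e , w′)
  run skip inst skip⇒ = ε
  run (wr a) inst wr⇒ = write-move (inst tt) ◅ ε
  run (a ⨾ b) inst (seq⇒ d d′) = run a (inst ∘ inj₁) d ◅◅ run b (inst ∘ inj₂) d′
  run (loop a f back) {emb} {e} inst (back⇒ {x = x} {w″ = w″} eq d d′ d″) =
    run a (inst ∘ inj₁) d ◅◅ read-move (inst (inj₂ nothing)) ◅
    subst (Star Move _) (cong (λ b → (if b then entry (loop a f back) emb e else e) , w″) eq)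
      (run (f x) (inst ∘ inj₂ ∘ just ∘ (x ,_)) d′) ◅◅
    run (loop a f back) inst d″
  run (loop a f back) {emb} {e} inst (exit⇒ {x = x} {w″ = w″} eq d d′) =
    run a (inst ∘ inj₁) d ◅◅ read-move (inst (inj₂ nothing)) ◅
    subst (Star Move _) (cong (λ b → (if b then entry (loop a f back) emb e else e) , w″) eq)
      (run (f x) (inst ∘ inj₂ ∘ just ∘ (x ,_)) d′)

states : (c : Cmd) → List (St c)
states skip            = []
states (wr a)          = [ tt ]
states (a ⨾ b)         = map inj₁ (states a) ++ map inj₂ (states b)
states (loop a f back) = map inj₁ (states a) ++ inj₂ nothing ∷
                         concatMap (λ x → map (inj₂ ∘ just ∘ (x ,_)) (states (f x))) (allFin 3)

∈-states : ∀ c s → s ∈ states c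
∈-states (wr a)          tt       = here refl
∈-states (a ⨾ b)         (inj₁ s) = ∈-++⁺ˡ (∈-map⁺ inj₁ (∈-states a s))
∈-states (a ⨾ b)         (inj₂ s) = ∈-++⁺ʳ _ (∈-map⁺ inj₂ (∈-states b s))
∈-states (loop a f back) (inj₁ s) = ∈-++⁺ˡ (∈-map⁺ inj₁ (∈-states a s))
∈-states (loop a f back) (inj₂ nothing) = ∈-++⁺ʳ (map inj₁ (states a)) (here refl)
∈-states (loop a f back) (inj₂ (just (x , s))) = ∈-++⁺ʳ (map inj₁ (states a)) (there
  (∈-concatMap⁺ (λ x → map (inj₂ ∘ just ∘ (x ,_)) (states (f x)))
    (lose (∈-allFin x) (∈-map⁺ (inj₂ ∘ just ∘ (x ,_)) (∈-states (f x) s)))))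

-- Transition tables and acceptance

data Op : Set where
  put get : Sym → Op

Transition : Set
Transition = ℕ × Op × ℕ

puts gets : List Op → Word
puts []            = []
puts (put a ∷ ops) = a ∷ puts ops
puts (get a ∷ ops) = puts ops
gets []            = []
gets (put a ∷ ops) = gets ops
gets (get a ∷ ops) = a ∷ gets ops

module _ (T : List Transition) where

  data QueueStep : ℕ × Word → ℕ × Word → Set where
    put-step : ∀ {p a q w} → (p , put a , q) ∈ T → QueueStep (p , w) (q , w ++ [ a ])
    get-step : ∀ {p a q w} → (p , get a , q) ∈ T → QueueStep (p , a ∷ w) (q , w)

  data Path : ℕ → List Op → ℕ → Set where
    []  : ∀ {p} → Path p [] p
    _∷_ : ∀ {p o q ops r} → (p , o , q) ∈ T → Path q ops r → Path p (o ∷ ops) r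

  -- The word w that is in the queue is only compared with the total input and
  -- output of the path: symbols may be read before they have been written.
  Accepting : ℕ → Word → Set
  Accepting p w = ∃[ ops ] (Path p ops 0 × w ++ puts ops ≡ gets ops)

-- State `1 + 2k` still has to write the numeral of `k`. These states are odd and the codes of
-- program states are even, so the two parts of a table never interfere; `2` is the code of `ini`.
next : ℕ → Op × ℕ
next zero    = put sep , 2
next (suc k) = put one , suc (2 * k)

-- Writes the number m into the queue, starting in state 1 + 2m.
input : ℕ → List Transition
input zero    = [ (1 , next 0) ]
input (suc m) = (suc (2 * suc m) , next (suc m)) ∷ input m

∈-input⁺ : ∀ {k m} → k ≤ m → (suc (2 * k) , next k) ∈ input m
∈-input⁺ {m = zero}  z≤n = here refl
∈-input⁺ {m = suc m} k≤ with m≤n⇒m<n∨m≡n k≤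
... | inj₁ (s≤s k≤m) = there (∈-input⁺ k≤m)
... | inj₂ refl      = here refl

∈-input⁻ : ∀ {p o q} m → (p , o , q) ∈ input m → ∃[ k ] (k ≤ m × p ≡ suc (2 * k) × (o , q) ≡ next k)
∈-input⁻ zero    (here refl) = 0 , z≤n , refl , refl
∈-input⁻ (suc m) (here refl) = suc m , ≤-refl , refl , refl
∈-input⁻ (suc m) (there t) with ∈-input⁻ m t
... | k , k≤m , eq , nx = k , m≤n⇒m≤1+n k≤m , eq , nx

data State (c : Cmd) : Set where
  acc ini fin fin₂ rej : State c
  st : St c → State c

module Machine (c : Cmd) where

  -- The first symbol of the stored result is `sep` exactly when the result is zero. Then only `end`
  -- is left, which `fin₂` removes, so acceptance leaves the queue empty.
  verdict : Sym → State c
  verdict one = rej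
  verdict sep = fin₂
  verdict end = rej

  Δ : State c → Instr (State c)
  Δ acc    = halt
  -- The input part writes only a numeral; this `end` completes it to a stored list with one entry.
  Δ ini    = write end (entry c st fin)
  Δ fin    = read verdict
  Δ fin₂   = read (λ _ → acc)
  Δ rej    = halt
  Δ (st s) = instr c st fin s

  -- The order matters: `acc` and `ini` come first and so receive the codes `0` and `2` to which
  -- `Accepting` and `next` refer.
  allStates : List (State c)
  allStates = acc ∷ ini ∷ fin ∷ fin₂ ∷ rej ∷ map st (states c)

  ∈-allStates : ∀ x → x ∈ allStates
  ∈-allStates acc    = here refl
  ∈-allStates ini    = there (here refl)
  ∈-allStates fin    = there (there (here refl))
  ∈-allStates fin₂   = there (there (there (here refl)))
  ∈-allStates rej    = there (there (there (there (here refl))))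
  ∈-allStates (st s) = there (there (there (there (there (∈-map⁺ st (∈-states c s))))))

  ⌜_⌝ : State c → ℕ
  ⌜ x ⌝ = 2 * toℕ (index (∈-allStates x))

  ⌜⌝-injective : ∀ {x y} → ⌜ x ⌝ ≡ ⌜ y ⌝ → x ≡ y
  ⌜⌝-injective {x} {y} eq = trans (lookup-index (∈-allStates x))
    (trans (cong (List.lookup allStates) same-index) (sym (lookup-index (∈-allStates y))))
    where
    same-index : index (∈-allStates x) ≡ index (∈-allStates y)
    same-index = toℕ-injective (*-cancelˡ-≡ _ _ 2 eq)

  outgoing : State c → Instr (State c) → List Transition
  outgoing x (write a y) = [ (⌜ x ⌝ , put a , ⌜ y ⌝) ]
  outgoing x (read g)    = map (λ a → ⌜ x ⌝ , get a , ⌜ g a ⌝) (allFin 3)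
  outgoing x halt        = []

  program : List Transition
  program = concatMap (λ x → outgoing x (Δ x)) allStates

  table : ℕ → List Transition
  table m = input m ++ program

  data Fits : Instr (State c) → Op → ℕ → Set where
    write-fits : ∀ {a y} → Fits (write a y) (put a) ⌜ y ⌝
    read-fits  : ∀ {g a} → Fits (read g) (get a) ⌜ g a ⌝

  ∈-outgoing⁺ : ∀ {x i o q} → Fits i o q → (⌜ x ⌝ , o , q) ∈ outgoing x i
  ∈-outgoing⁺ write-fits      = here refl
  ∈-outgoing⁺ {x} (read-fits {g} {a}) = ∈-map⁺ (λ a → ⌜ x ⌝ , get a , ⌜ g a ⌝) (∈-allFin a)

  ∈-outgoing⁻ : ∀ {x p o q} i → (p , o , q) ∈ outgoing x i → p ≡ ⌜ x ⌝ × Fits i o q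
  ∈-outgoing⁻ (write a y) (here refl) = refl , write-fits
  ∈-outgoing⁻ {x} (read g) t with ∈-map⁻ (λ a → ⌜ x ⌝ , get a , ⌜ g a ⌝) t
  ... | a , _ , refl = refl , read-fits

  ∈-program⁺ : ∀ x {o q} → Fits (Δ x) o q → (⌜ x ⌝ , o , q) ∈ program
  ∈-program⁺ x fit = ∈-concatMap⁺ (λ x → outgoing x (Δ x)) (lose (∈-allStates x) (∈-outgoing⁺ fit))

  ∈-program⁻ : ∀ {p o q} → (p , o , q) ∈ program → ∃[ x ] (p ≡ ⌜ x ⌝ × Fits (Δ x) o q)
  ∈-program⁻ t with find (∈-concatMap⁻ (λ x → outgoing x (Δ x)) {xs = allStates} t)
  ... | x , _ , t′ = x , ∈-outgoing⁻ (Δ x) t′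

  fits : ∀ {m x o q} → (⌜ x ⌝ , o , q) ∈ table m → Fits (Δ x) o q
  fits {m} {x} t with ∈-++⁻ (input m) t
  ... | inj₁ t′ with ∈-input⁻ m t′
  ...   | k , _ , eq , _ = ⊥-elim (even≢odd (toℕ (index (∈-allStates x))) k eq)
  fits {m} {x} {o} {q} t | inj₂ t′ with ∈-program⁻ t′
  ...   | y , eq , fit = subst (λ z → Fits (Δ z) o q) (sym (⌜⌝-injective {x} {y} eq)) fit

  fits-next : ∀ {m k o q} → (suc (2 * k) , o , q) ∈ table m → (o , q) ≡ next k
  fits-next {m} {k} t with ∈-++⁻ (input m) t
  ... | inj₁ t′ with ∈-input⁻ m t′
  ...   | j , _ , eq , nx = trans nx (cong next (*-cancelˡ-≡ j k 2 (sym (suc-injective eq))))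
  fits-next {m} {k} t | inj₂ t′ with ∈-program⁻ t′
  ...   | y , eq , _ = ⊥-elim (even≢odd (toℕ (index (∈-allStates y))) k (sym eq))

  move⇒step : ∀ {m x w y w′} → Move Δ (x , w) (y , w′) → QueueStep (table m) (⌜ x ⌝ , w) (⌜ y ⌝ , w′)
  move⇒step {m} {x} (write-move eq) = put-step (∈-++⁺ʳ (input m) (∈-program⁺ x (subst (λ i → Fits i _ _) (sym eq) write-fits)))
  move⇒step {m} {x} (read-move eq)  = get-step (∈-++⁺ʳ (input m) (∈-program⁺ x (subst (λ i → Fits i _ _) (sym eq) read-fits)))

  moves⇒steps : ∀ {m x w y w′} → Star (Move Δ) (x , w) (y , w′) → Star (QueueStep (table m)) (⌜ x ⌝ , w) (⌜ y ⌝ , w′)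
  moves⇒steps ε        = ε
  moves⇒steps (s ◅ ss) = move⇒step s ◅ moves⇒steps ss

  input-steps : ∀ {m} k w → k ≤ m → Star (QueueStep (table m)) (suc (2 * k) , w) (2 , w ++ num k)
  input-steps zero    w k≤m = put-step (∈-++⁺ˡ (∈-input⁺ k≤m)) ◅ ε
  input-steps (suc k) w k<m = put-step (∈-++⁺ˡ (∈-input⁺ k<m)) ◅
    subst (Star _ _) (cong (2 ,_) (++-assoc w [ one ] (num k))) (input-steps k (w ++ [ one ]) (≤-trans (n≤1+n k) k<m))

  -- The machine is deterministic and never reads from an empty queue on its
  -- actual run, so an accepting path must follow that run.
  accepting-move : ∀ {m x w y w′} → Move Δ (x , w) (y , w′) → Accepting (table m) ⌜ x ⌝ w → Accepting (table m) ⌜ y ⌝ w′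
  accepting-move s (ops , path , eq) = follow s path refl eq
    where
    -- The start of the path is generalised to `p` so that the empty path can be matched. There `p`
    -- is `0`, hence `x` is `acc`, from which no move starts.
    follow : ∀ {m x w y w′ p ops} → Move Δ (x , w) (y , w′) → Path (table m) p ops 0 → p ≡ ⌜ x ⌝ →
             w ++ puts ops ≡ gets ops → Accepting (table m) ⌜ y ⌝ w′
    follow {x = x} s [] p≡ eq with ⌜⌝-injective {acc} {x} p≡
    follow (write-move ()) [] p≡ eq | refl
    follow (read-move ())  [] p≡ eq | refl
    follow {m} {x} s (t ∷ path) refl eq with Δ x in Δx | fits {m} {x} t
    follow {w = w} (write-move e) (t ∷ path) refl eq | _ | fit with trans (sym e) Δx
    follow {w = w} (write-move e) (_∷_ {ops = ops} t path) refl eq | _ | write-fits {a} | refl =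
      ops , path , trans (++-assoc w [ a ] (puts ops)) eq
    follow (read-move e) (t ∷ path) refl eq | _ | fit with trans (sym e) Δx
    -- The actual queue is nonempty here, so the equation of total words forces the path to read its
    -- actual first symbol.
    follow (read-move {w = w} e) (_∷_ {ops = ops} t path) refl eq | _ | read-fits | refl with ∷-injectiveˡ eq
    ... | refl = ops , path , ∷-injectiveʳ eq

  accepting-moves : ∀ {m x w y w′} → Star (Move Δ) (x , w) (y , w′) → Accepting (table m) ⌜ x ⌝ w → Accepting (table m) ⌜ y ⌝ w′
  accepting-moves ε        ac = ac
  accepting-moves (s ◅ ss) ac = accepting-moves ss (accepting-move s ac)

  accepting-input : ∀ {m} k w → Accepting (table m) (suc (2 * k)) w → Accepting (table m) 2 (w ++ num k)
  accepting-input {m} zero    w (ops , t ∷ path , eq) with fits-next {m} {0} t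
  ... | refl = _ , path , trans (++-assoc w [ sep ] _) eq
  accepting-input {m} (suc k) w (ops , t ∷ path , eq) with fits-next {m} {suc k} t
  ... | refl = subst (Accepting (table m) 2) (++-assoc w [ one ] (num k))
                 (accepting-input k (w ++ [ one ]) (_ , path , trans (++-assoc w [ one ] _) eq))

  runs : ∀ {m y} → c ⊩ [ m ] ⇝ [ y ] → Star (Move Δ) (ini , num m) (fin , queue [ y ])
  runs {m} {y} (onQueue d) = write-move refl ◅
    subst (λ v → Star (Move Δ) (entry c st fin , v) (fin , queue [ y ])) (cong (_++ [ end ]) (++-identityʳ (num m)))
      (run Δ c (λ _ → refl) d)

  accepts : ∀ {m} → c ⊩ [ m ] ⇝ [ 0 ] → Star (QueueStep (table m)) (suc (2 * m) , []) (0 , [])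
  accepts {m} d = input-steps m [] ≤-refl ◅◅
    moves⇒steps (runs d ◅◅ read-move {x = fin} refl ◅ read-move {x = fin₂} refl ◅ ε)

  rejects : ∀ {m y} → c ⊩ [ m ] ⇝ [ suc y ] → ¬ Accepting (table m) (suc (2 * m)) []
  rejects {m} d ac with accepting-moves (runs d ◅◅ read-move {x = fin} refl ◅ ε) (accepting-input m [] ac)
  -- The empty path is impossible because the code of `rej` is not `0`, and a first transition is
  -- impossible because `rej` halts.
  ... | _ , t ∷ path , eq with fits {m} {rej} t
  ...   | ()

-- Words on the edges of a network

module Network (G : DiGraph) where
  open DiGraph G

  Joins : Edge → Node → Node → Set
  Joins = Multigraph.Joins (∇ G)

  Act : Node → Set
  Act = Action G (λ _ → 3)

  -- A proof of Joins ξ u v stands for the end of ξ at u; when ξ is a loop, its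
  -- orientation tells the two ends apart.
  near : ∀ {ξ u v} → Joins ξ u v → Sym → Act u
  near {ξ} (inj₁ (t , _)) = send ξ (sym t)
  near {ξ} (inj₂ (_ , h)) = recv ξ (sym h)

  sends receives : ∀ {u} → Edge → Act u → Word
  sends ξ (send ζ _ b) with ξ ≟ ζ
  ... | yes _ = [ b ]
  ... | no  _ = []
  sends ξ (recv _ _ _) = []
  receives ξ (send _ _ _) = []
  receives ξ (recv ζ _ b) with ξ ≟ ζ
  ... | yes _ = [ b ]
  ... | no  _ = []

  symbols : ∀ {ξ u v} → Joins ξ u v → Act u → Word
  symbols {ξ} (inj₁ _) = sends ξ
  symbols {ξ} (inj₂ _) = receives ξ

  history : ∀ {ξ u v} → Joins ξ u v → List (Act u) → Word
  history J = concatMap (symbols J)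

  sends-self : ∀ {u} ξ (e : u ≡ tail ξ) b → sends ξ (send ξ e b) ≡ [ b ]
  sends-self ξ e b with ξ ≟ ξ
  ... | yes _ = refl
  ... | no ¬p = ⊥-elim (¬p refl)

  receives-self : ∀ {u} ξ (e : u ≡ head ξ) b → receives ξ (recv ξ e b) ≡ [ b ]
  receives-self ξ e b with ξ ≟ ξ
  ... | yes _ = refl
  ... | no ¬p = ⊥-elim (¬p refl)

  sends-other : ∀ {u ξ ζ} (e : u ≡ tail ζ) b → ξ ≢ ζ → sends ξ (send ζ e b) ≡ []
  sends-other {ξ = ξ} {ζ} e b ≢ with ξ ≟ ζ
  ... | yes p = ⊥-elim (≢ p)
  ... | no  _ = refl

  receives-other : ∀ {u ξ ζ} (e : u ≡ head ζ) b → ξ ≢ ζ → receives ξ (recv ζ e b) ≡ []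
  receives-other {ξ = ξ} {ζ} e b ≢ with ξ ≟ ζ
  ... | yes p = ⊥-elim (≢ p)
  ... | no  _ = refl

  symbols-near : ∀ {ξ u v} (J : Joins ξ u v) a → symbols J (near J a) ≡ [ a ]
  symbols-near (inj₁ (t , _)) a = sends-self _ (sym t) a
  symbols-near (inj₂ (_ , h)) a = receives-self _ (sym h) a

  symbols-other : ∀ {ξ ζ u v v′} (J : Joins ξ u v) (K : Joins ζ u v′) a → ξ ≢ ζ → symbols J (near K a) ≡ []
  symbols-other (inj₁ _) (inj₁ (t , _)) a ≢ = sends-other (sym t) a ≢
  symbols-other (inj₁ _) (inj₂ _)       a ≢ = refl
  symbols-other (inj₂ _) (inj₁ _)       a ≢ = refl
  symbols-other (inj₂ _) (inj₂ (_ , h)) a ≢ = receives-other (sym h) a ≢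

  turn : ∀ {ξ u v z} → v ≡ z → Joins ξ u v → Joins ξ z u
  turn refl = swap

  -- The case of a cycle of length one: both ports belong to one loop, and one of them sends while
  -- the other receives.
  symbols-opposite : ∀ {ξ u v} (e : v ≡ u) (J : Joins ξ u v) a →
                     symbols J (near (turn e J) a) ≡ [] × symbols (turn e J) (near J a) ≡ []
  symbols-opposite refl (inj₁ _) a = refl , refl
  symbols-opposite refl (inj₂ _) a = refl , refl

  module _ (N : ℕ) where

    Table : Node → Set
    Table j = List (Fin N × Act j × Fin N)

    data Run {j} (T : Table j) : Fin N → List (Act j) → Fin N → Set where
      []  : ∀ {p} → Run T p [] p
      _∷_ : ∀ {p α q w r} → (p , α , q) ∈ T → Run T q w r → Run T p (α ∷ w) r

    module _ (T : ∀ j → Table j) (start : Node → Fin N) where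

      protocol : Protocol G
      protocol = record
        { #msgs   = λ _ → 3
        ; machine = λ j → record { #states = N ; transitions = T j ; initial = start j }
        }

      consAt : (i : Node) → Act i → (∀ j → List (Act j)) → ∀ j → List (Act j)
      consAt i α w j with i ≟ j
      ... | yes refl = α ∷ w i
      ... | no  _    = w j

      consAt-same : ∀ i α w → consAt i α w i ≡ α ∷ w i
      consAt-same i α w with i ≟ i
      ... | yes refl = refl
      ... | no ¬p    = ⊥-elim (¬p refl)

      concatMap-consAt : ∀ {i α w} (φ : ∀ {j} → Act j → Word) → φ α ≡ [] → ∀ j →
                         concatMap φ (consAt i α w j) ≡ concatMap φ (w j)
      concatMap-consAt {i} {α} {w} φ eq j with i ≟ j
      ... | yes refl = cong (_++ concatMap φ (w i)) eq
      ... | no  _    = refl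

      consAt-run : ∀ {i α w} {S S₁ S′ : Node → Fin N} → (S i , α , S₁ i) ∈ T i → (∀ j → j ≢ i → S₁ j ≡ S j) →
                   (∀ j → Run (T j) (S₁ j) (w j) (S′ j)) → ∀ j → Run (T j) (S j) (consAt i α w j) (S′ j)
      consAt-run {i} t frame rs j with i ≟ j
      ... | yes refl = t ∷ rs i
      ... | no i≢j   = subst (λ p → Run (T j) p _ _) (frame j (≢-sym i≢j)) (rs j)

      -- The interleaving is forgotten. What survives is a local run for each node and, since
      -- channels are FIFO, a balance of words for each edge. A step prepends one action at `i` and
      -- affects only the balance of `β`.
      histories : ∀ {S C S′ C′} → Star (Step protocol) (S , C) (S′ , C′) →
                  ∃[ w ] ((∀ j → Run (T j) (S j) (w j) (S′ j)) ×
                          (∀ ξ → C ξ ++ concatMap (sends ξ) (w (tail ξ)) ≡ concatMap (receives ξ) (w (head ξ)) ++ C′ ξ))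
      histories ε = (λ _ → []) , (λ _ → []) , λ ξ → ++-identityʳ _
      histories {C = C} {C′ = C′} (send-step i β refl b t Cβ frame Cother ◅ ss) with histories ss
      ... | w , rs , bal = consAt i α w , consAt-run t frame rs , balance
        where
        α = send β refl b
        balance : ∀ ξ → C ξ ++ concatMap (sends ξ) (consAt i α w (tail ξ)) ≡
                        concatMap (receives ξ) (consAt i α w (head ξ)) ++ C′ ξ
        balance ξ rewrite concatMap-consAt {i} {α} {w} (receives ξ) refl (head ξ) with ξ ≟ β
        ... | yes refl rewrite consAt-same i α w | sends-self β refl b =
          trans (sym (++-assoc (C β) [ b ] _)) (trans (cong (_++ concatMap (sends β) (w (tail β))) (sym Cβ)) (bal β))
        ... | no ξ≢β rewrite concatMap-consAt {i} {α} {w} (sends ξ) (sends-other refl b ξ≢β) (tail ξ) | sym (Cother ξ ξ≢β) = bal ξ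
      histories {C = C} {C′ = C′} (recv-step i β refl b t Cβ frame Cother ◅ ss) with histories ss
      ... | w , rs , bal = consAt i α w , consAt-run t frame rs , balance
        where
        α = recv β refl b
        balance : ∀ ξ → C ξ ++ concatMap (sends ξ) (consAt i α w (tail ξ)) ≡
                        concatMap (receives ξ) (consAt i α w (head ξ)) ++ C′ ξ
        balance ξ rewrite concatMap-consAt {i} {α} {w} (sends ξ) refl (tail ξ) with ξ ≟ β
        ... | yes refl rewrite consAt-same i α w | receives-self β refl b | Cβ = cong (b ∷_) (bal β)
        ... | no ξ≢β rewrite concatMap-consAt {i} {α} {w} (receives ξ) (receives-other refl b ξ≢β) (head ξ) | sym (Cother ξ ξ≢β) = bal ξ

      Effect : ∀ {ξ u v} → Joins ξ u v → Sym → Word → Word → Set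
      Effect (inj₁ _) a x x′ = x′ ≡ x ++ [ a ]
      Effect (inj₂ _) a x x′ = x ≡ a ∷ x′

      -- The frame conditions express that relays used on the way are back in their former states
      -- and that all intermediate channels are restored.
      record Reach (S : Node → Fin N) (C : Edge → Word) (u : Node) (q : Fin N) (ξ : Edge) (x : Word) : Set where
        field
          S′       : Node → Fin N
          C′       : Edge → Word
          steps    : Star (Step protocol) (S , C) (S′ , C′)
          at-node  : S′ u ≡ q
          off-node : ∀ j → j ≢ u → S′ j ≡ S j
          at-edge  : C′ ξ ≡ x
          off-edge : ∀ ζ → ζ ≢ ξ → C′ ζ ≡ C ζ

      act : ∀ {ξ u v p q a x S C} (J : Joins ξ u v) → (p , near J a , q) ∈ T u → S u ≡ p → Effect J a (C ξ) x →
            Reach S C u q ξ x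
      act {ξ} {u} {q = q} {a} {x} {S} {C} J t refl eff = record
        { S′       = S₁
        ; C′       = C₁
        ; steps    = step J t eff ◅ ε
        ; at-node  = updateAt-updates u S
        ; off-node = λ j → updateAt-minimal j u S
        ; at-edge  = updateAt-updates ξ C
        ; off-edge = λ ζ → updateAt-minimal ζ ξ C
        }
        where
        S₁ = updateAt S u (const q)
        C₁ = updateAt C ξ (const x)
        step : (J : Joins ξ u _) → (S u , near J a , q) ∈ T u → Effect J a (C ξ) x → Step protocol (S , C) (S₁ , C₁)
        step (inj₁ (t , _)) tr eff = send-step u ξ (sym t) a (subst (λ r → (S u , _ , r) ∈ T u) (sym (updateAt-updates u S)) tr)
          (trans (updateAt-updates ξ C) eff) (λ j → updateAt-minimal j u S) (λ ζ → updateAt-minimal ζ ξ C)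
        step (inj₂ (_ , h)) tr eff = recv-step u ξ (sym h) a (subst (λ r → (S u , _ , r) ∈ T u) (sym (updateAt-updates u S)) tr)
          (trans eff (cong (a ∷_) (sym (updateAt-updates ξ C)))) (λ j → updateAt-minimal j u S) (λ ζ → updateAt-minimal ζ ξ C)

  -- Relays and the transport of a symbol along the cycle

  module _ {k : ℕ} where

    -- State `zero` is rest and `mid a` remembers `a` between the two actions of a hop; this takes
    -- four states, and `k` pads all machines to a common size.
    mid : Sym → Fin (4 + k)
    mid a = suc (a ↑ˡ k)

    hop : ∀ {x} → (Sym → Act x) → (Sym → Act x) → Sym → Table (4 + k) x
    hop α β a = (zero , α a , mid a) ∷ (mid a , β a , zero) ∷ []

    hops : ∀ {x} → (Sym → Act x) → (Sym → Act x) → Table (4 + k) x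
    hops α β = concatMap (hop α β) (allFin 3)

    -- With one incoming and one outgoing edge the relay forwards. With two outgoing edges it
    -- guesses a symbol and sends it both ways; with two incoming edges it checks that both bring
    -- the same symbol.
    relay : ∀ {ξ ζ u x v} → Joins ξ u x → Joins ζ x v → Table (4 + k) x
    relay J K@(inj₁ _) = hops (near (swap J)) (near K)
    relay J K@(inj₂ _) = hops (near K) (near (swap J))

    ∈-hops : ∀ {x} (α β : Sym → Act x) a → (zero , α a , mid a) ∈ hops α β × (mid a , β a , zero) ∈ hops α β
    ∈-hops α β a = ∈-concatMap⁺ (hop α β) (lose (∈-allFin a) (here refl)) ,
                   ∈-concatMap⁺ (hop α β) (lose (∈-allFin a) (there (here refl)))

    ∈-hops⁻ : ∀ {x α β p γ q} → (p , γ , q) ∈ hops {x} α β →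
              (∃[ a ] (p ≡ zero × γ ≡ α a × q ≡ mid a)) ⊎ (∃[ a ] (p ≡ mid a × γ ≡ β a × q ≡ zero))
    ∈-hops⁻ {α = α} {β} t with find (∈-concatMap⁻ (hop α β) {xs = allFin 3} t)
    ... | a , _ , here refl         = inj₁ (a , refl , refl , refl)
    ... | a , _ , there (here refl) = inj₂ (a , refl , refl , refl)

    -- A run from rest to rest consists of complete pairs `α a`, `β a`, since `mid` is injective and
    -- the final state excludes a half-finished hop.
    hops-balanced : ∀ {x} {α β : Sym → Act x} (φ ψ : Act x → Word) →
                    (∀ a → φ (α a) ≡ [ a ]) → (∀ a → φ (β a) ≡ []) →
                    (∀ a → ψ (α a) ≡ []) → (∀ a → ψ (β a) ≡ [ a ]) →
                    ∀ {w} → Run (4 + k) (hops α β) zero w zero → concatMap φ w ≡ concatMap ψ w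
    hops-balanced φ ψ φα φβ ψα ψβ [] = refl
    hops-balanced {α = α} {β} φ ψ φα φβ ψα ψβ (t ∷ r) with ∈-hops⁻ {α = α} {β} t
    hops-balanced {α = α} {β} φ ψ φα φβ ψα ψβ (t ∷ (t′ ∷ r)) | inj₁ (a , refl , refl , refl) with ∈-hops⁻ {α = α} {β} t′
    ... | inj₂ (b , a≡b , refl , refl) with ↑ˡ-injective k a b (Fin.suc-injective a≡b)
    ...   | refl rewrite φα a | φβ a | ψα a | ψβ a = cong (a ∷_) (hops-balanced φ ψ φα φβ ψα ψβ r)

    relay-balanced : ∀ {ξ ζ u x v w} (J : Joins ξ u x) (K : Joins ζ x v) → ξ ≢ ζ →
                     Run (4 + k) (relay J K) zero w zero → history (swap J) w ≡ history K w
    relay-balanced J K@(inj₁ _) ≢ r = hops-balanced (symbols (swap J)) (symbols K)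
      (symbols-near (swap J)) (λ a → symbols-other (swap J) K a ≢)
      (λ a → symbols-other K (swap J) a (≢-sym ≢)) (symbols-near K) r
    relay-balanced J K@(inj₂ _) ≢ r = sym (hops-balanced (symbols K) (symbols (swap J))
      (symbols-near K) (λ a → symbols-other K (swap J) a (≢-sym ≢))
      (λ a → symbols-other (swap J) K a ≢) (symbols-near (swap J)) r)

    module _ (T : ∀ j → Table (4 + k) j) (start : Node → Fin (4 + k)) where

      private
        Eff : ∀ {ξ u v} → Joins ξ u v → Sym → Word → Word → Set
        Eff = Effect (4 + k) T start

      -- A relay can perform the action on its second edge only when that edge
      -- leaves it or has been served from the far side.
      relay-order : ∀ {ξ ζ u x v} (J : Joins ξ u x) (K : Joins ζ x v) a →
        (Eff K a [] [ a ] × Eff (swap K) a [ a ] [] ×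
         (zero , near (swap J) a , mid a) ∈ relay J K × (mid a , near K a , zero) ∈ relay J K) ⊎
        (Eff (swap K) a [] [ a ] × Eff K a [ a ] [] ×
         (zero , near K a , mid a) ∈ relay J K × (mid a , near (swap J) a , zero) ∈ relay J K)
      relay-order J K@(inj₁ _) a = inj₁ (refl , refl , ∈-hops (near (swap J)) (near K) a)
      relay-order J K@(inj₂ _) a = inj₂ (refl , refl , ∈-hops (near K) (near (swap J)) a)

      -- An action of `z` on the last edge amounts, after all relays have acted, to an action at the
      -- end of the first edge away from `node zero`. By induction the part of the cycle beyond the
      -- first relay behaves like one port on the second edge.
      pass : ∀ n (node : Fin (2 + n) → Node) (edge : Fin (1 + n) → Edge)
             (joins : ∀ i → Joins (edge i) (node (inject₁ i)) (node (suc i))) →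
             Injective _≡_ _≡_ edge → ∀ {z} (closed : node (fromℕ (suc n)) ≡ z) →
             (∀ i → node (suc (inject₁ i)) ≢ z) →
             (∀ i {t} → t ∈ relay (joins (inject₁ i)) (joins (suc i)) → t ∈ T (node (suc (inject₁ i)))) →
             ∀ {S C p q a x} →
             (p , near (turn closed (joins (fromℕ n))) a , q) ∈ T z →
             S z ≡ p → (∀ j → j ≢ z → S j ≡ zero) → (∀ i → C (edge (suc i)) ≡ []) →
             Eff (swap (joins zero)) a (C (edge zero)) x →
             Reach (4 + k) T start S C z q (edge zero) x
      pass zero node edge joins inj refl x≢z relays t Sz idle empty eff = act (4 + k) T start (swap (joins zero)) t Sz eff
      pass (suc n) node edge joins inj {z} closed x≢z relays {S} {C} {p} {q} {a} {x} t Sz idle empty eff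
        with relay-order (joins zero) (joins (suc zero)) a
      -- The second edge leaves the relay: the relay serves both of its edges, and then the rest of
      -- the cycle takes the symbol.
      ... | inj₁ (eff₁ , eff₂ , t₁ , t₂) = record
        { S′       = S′ r₃
        ; C′       = C′ r₃
        ; steps    = steps r₁ ◅◅ steps r₂ ◅◅ steps r₃
        ; at-node  = at-node r₃
        ; off-node = λ j j≢z → trans (off-node r₃ j j≢z) (S₂≡S j)
        ; at-edge  = trans (off-edge r₃ e₀ e₀≢e₁) (trans (off-edge r₂ e₀ e₀≢e₁) (at-edge r₁))
        ; off-edge = λ ζ ζ≢e₀ → C₃≡C ζ ζ≢e₀
        }
        where
        open Reach
        y = node (suc zero)
        e₀ = edge zero
        e₁ = edge (suc zero)
        e₀≢e₁ : e₀ ≢ e₁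
        e₀≢e₁ eq with inj eq
        ... | ()
        r₁ = act (4 + k) T start {S = S} {C} (swap (joins zero)) (relays zero t₁)
               (idle y (x≢z zero)) eff
        r₂ = act (4 + k) T start {S = S′ r₁} {C′ r₁} (joins (suc zero)) (relays zero t₂)
               (at-node r₁)
               (subst (λ v → Eff (joins (suc zero)) a v [ a ]) (sym (trans (off-edge r₁ e₁ (≢-sym e₀≢e₁)) (empty zero))) eff₁)
        S₂≡S : ∀ j → S′ r₂ j ≡ S j
        S₂≡S j with j ≟ y
        ... | yes refl = trans (at-node r₂) (sym (idle y (x≢z zero)))
        ... | no  j≢y  = trans (off-node r₂ j j≢y) (off-node r₁ j j≢y)
        C₂≡C : ∀ ζ → ζ ≢ e₀ → ζ ≢ e₁ → C′ r₂ ζ ≡ C ζ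
        C₂≡C ζ ≢₀ ≢₁ = trans (off-edge r₂ ζ ≢₁) (off-edge r₁ ζ ≢₀)
        r₃ = pass n (node ∘ suc) (edge ∘ suc) (joins ∘ suc) (Fin.suc-injective ∘ inj) closed (x≢z ∘ suc) (λ i → relays (suc i))
               {S′ r₂} {C′ r₂} t (trans (S₂≡S z) Sz) (λ j j≢z → trans (S₂≡S j) (idle j j≢z))
               (λ i → trans (C₂≡C (edge (suc (suc i))) (λ eq → 0≢1+n (sym (inj eq)))
                              (λ eq → 0≢1+n (sym (Fin.suc-injective (inj eq)))))
                            (empty (suc i)))
               (subst (λ v → Eff (swap (joins (suc zero))) a v []) (sym (at-edge r₂)) eff₂)
        C₃≡C : ∀ ζ → ζ ≢ e₀ → C′ r₃ ζ ≡ C ζ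
        C₃≡C ζ ≢₀ with ζ ≟ e₁
        ... | yes refl = trans (at-edge r₃) (sym (empty zero))
        ... | no  ≢₁   = trans (off-edge r₃ ζ ≢₁) (C₂≡C ζ ≢₀ ≢₁)
      -- The second edge enters the relay: the rest of the cycle must first put the symbol on it.
      ... | inj₂ (eff₁ , eff₂ , t₁ , t₂) = record
        { S′       = S′ r₃
        ; C′       = C′ r₃
        ; steps    = steps r₁ ◅◅ steps r₂ ◅◅ steps r₃
        ; at-node  = trans (S₃≡S₁ z) (at-node r₁)
        ; off-node = λ j j≢z → trans (S₃≡S₁ j) (off-node r₁ j j≢z)
        ; at-edge  = at-edge r₃
        ; off-edge = λ ζ ζ≢e₀ → trans (off-edge r₃ ζ ζ≢e₀) (C₂≡C ζ)
        }
        where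
        open Reach
        y = node (suc zero)
        e₀ = edge zero
        e₁ = edge (suc zero)
        e₀≢e₁ : e₀ ≢ e₁
        e₀≢e₁ eq with inj eq
        ... | ()
        r₁ = pass n (node ∘ suc) (edge ∘ suc) (joins ∘ suc) (Fin.suc-injective ∘ inj) closed (x≢z ∘ suc) (λ i → relays (suc i))
               {S} {C} t Sz idle (empty ∘ suc)
               (subst (λ v → Eff (swap (joins (suc zero))) a v [ a ]) (sym (empty zero)) eff₁)
        S₁y : S′ r₁ y ≡ zero
        S₁y = trans (off-node r₁ y (x≢z zero)) (idle y (x≢z zero))
        r₂ = act (4 + k) T start {S = S′ r₁} {C′ r₁} (joins (suc zero)) (relays zero t₁) S₁y
               (subst (λ v → Eff (joins (suc zero)) a v []) (sym (at-edge r₁)) eff₂)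
        C₂≡C : ∀ ζ → C′ r₂ ζ ≡ C ζ
        C₂≡C ζ with ζ ≟ e₁
        ... | yes refl = trans (at-edge r₂) (sym (empty zero))
        ... | no  ≢₁   = trans (off-edge r₂ ζ ≢₁) (off-edge r₁ ζ ≢₁)
        r₃ = act (4 + k) T start {S = S′ r₂} {C′ r₂} (swap (joins zero)) (relays zero t₂)
               (at-node r₂) (subst (λ v → Eff (swap (joins zero)) a v x) (sym (C₂≡C e₀)) eff)
        S₃≡S₁ : ∀ j → S′ r₃ j ≡ S′ r₁ j
        S₃≡S₁ j with j ≟ y
        ... | yes refl = trans (at-node r₃) (sym S₁y)
        ... | no  j≢y  = trans (off-node r₃ j j≢y) (off-node r₂ j j≢y)

  -- Goes round by alternately crossing an edge and passing a relay.
  histories-agree : ∀ n (node : Fin (2 + n) → Node) (edge : Fin (1 + n) → Edge)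
    (joins : ∀ i → Joins (edge i) (node (inject₁ i)) (node (suc i))) (w : ∀ j → List (Act j)) →
    (∀ i → history (joins i) (w (node (inject₁ i))) ≡ history (swap (joins i)) (w (node (suc i)))) →
    (∀ i → history (swap (joins (inject₁ i))) (w (node (suc (inject₁ i)))) ≡ history (joins (suc i)) (w (node (suc (inject₁ i))))) →
    history (joins zero) (w (node zero)) ≡ history (swap (joins (fromℕ n))) (w (node (fromℕ (suc n))))
  histories-agree zero    node edge joins w across along = across zero
  histories-agree (suc n) node edge joins w across along =
    trans (across zero) (trans (along zero)
      (histories-agree n (node ∘ suc) (edge ∘ suc) (joins ∘ suc) w (across ∘ suc) (along ∘ suc)))

-- The protocol of a queue machine on a cycle

module Ports (G : DiGraph) where
  open DiGraph G
  open Network G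

  -- With this choice the symbols in the queue are always those on the edge of J.
  perform : ∀ {ξ ζ u v v′} → Joins ξ u v → Joins ζ u v′ → Op → Act u
  perform J@(inj₁ _) K (put a) = near J a
  perform J@(inj₁ _) K (get a) = near K a
  perform J@(inj₂ _) K (put a) = near K a
  perform J@(inj₂ _) K (get a) = near J a

  concatMap-puts : ∀ {u} (φ : Act u → Word) (f : Op → Act u) → (∀ a → φ (f (put a)) ≡ [ a ]) → (∀ a → φ (f (get a)) ≡ []) →
                   ∀ ops → concatMap φ (map f ops) ≡ puts ops
  concatMap-puts φ f φput φget []            = refl
  concatMap-puts φ f φput φget (put a ∷ ops) = cong₂ _++_ (φput a) (concatMap-puts φ f φput φget ops)
  concatMap-puts φ f φput φget (get a ∷ ops) = cong₂ _++_ (φget a) (concatMap-puts φ f φput φget ops)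

  concatMap-gets : ∀ {u} (φ : Act u → Word) (f : Op → Act u) → (∀ a → φ (f (put a)) ≡ []) → (∀ a → φ (f (get a)) ≡ [ a ]) →
                   ∀ ops → concatMap φ (map f ops) ≡ gets ops
  concatMap-gets φ f φput φget []            = refl
  concatMap-gets φ f φput φget (put a ∷ ops) = cong₂ _++_ (φput a) (concatMap-gets φ f φput φget ops)
  concatMap-gets φ f φput φget (get a ∷ ops) = cong₂ _++_ (φget a) (concatMap-gets φ f φput φget ops)

  perform-balanced : ∀ {ξ ζ u v v′} (J : Joins ξ u v) (K : Joins ζ u v′) →
                     (∀ a → symbols J (near K a) ≡ [] × symbols K (near J a) ≡ []) → ∀ ops →
                     history J (map (perform J K) ops) ≡ history K (map (perform J K) ops) → puts ops ≡ gets ops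
  perform-balanced J@(inj₁ _) K dis ops eq = trans
    (sym (concatMap-puts (symbols J) (perform J K) (symbols-near J) (proj₁ ∘ dis) ops))
    (trans eq (concatMap-gets (symbols K) (perform J K) (proj₂ ∘ dis) (symbols-near K) ops))
  perform-balanced J@(inj₂ _) K dis ops eq = trans
    (sym (concatMap-puts (symbols K) (perform J K) (symbols-near K) (proj₂ ∘ dis) ops))
    (trans (sym eq) (concatMap-gets (symbols J) (perform J K) (proj₁ ∘ dis) (symbols-near J) ops))

  ends-disjoint : ∀ n (node : Fin (2 + n) → Node) (edge : Fin (1 + n) → Edge)
    (joins : ∀ i → Joins (edge i) (node (inject₁ i)) (node (suc i))) → Injective _≡_ _≡_ edge →
    (closed : node (fromℕ (suc n)) ≡ node zero) → ∀ a →
    let J = joins zero; K = turn closed (joins (fromℕ n))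
    in symbols J (near K a) ≡ [] × symbols K (near J a) ≡ []
  ends-disjoint zero    node edge joins inj closed a = symbols-opposite closed (joins zero) a
  ends-disjoint (suc n) node edge joins inj closed a =
    symbols-other (joins zero) (turn closed (joins (fromℕ (suc n)))) a (λ eq → 0≢1+n (inj eq)) ,
    symbols-other (turn closed (joins (fromℕ (suc n)))) (joins zero) a (λ eq → 0≢1+n (sym (inj eq)))

  history-turn : ∀ {ξ u v z} (e : v ≡ z) (J : Joins ξ u v) (w : ∀ j → List (Act j)) →
                 history (swap J) (w v) ≡ history (turn e J) (w z)
  history-turn refl J w = refl

  history-across : ∀ {ξ u v} (J : Joins ξ u v) (w : ∀ j → List (Act j)) →
                   concatMap (sends ξ) (w (tail ξ)) ≡ concatMap (receives ξ) (w (head ξ)) →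
                   history J (w u) ≡ history (swap J) (w v)
  history-across (inj₁ (refl , refl)) w eq = eq
  history-across (inj₂ (refl , refl)) w eq = sym eq

module Ring (G : DiGraph) (n : ℕ)
  (node : Fin (2 + n) → DiGraph.Node G) (edge : Fin (1 + n) → DiGraph.Edge G)
  (joins : ∀ i → Network.Joins G (edge i) (node (inject₁ i)) (node (suc i)))
  (closed : node (fromℕ (suc n)) ≡ node zero)
  (distinct-nodes : Injective _≡_ _≡_ (node ∘ inject₁))
  (distinct-edges : Injective _≡_ _≡_ edge) where
  open DiGraph G
  open Network G
  open Ports G

  v₀ : Node
  v₀ = node zero

  x : Fin n → Node
  x i = node (suc (inject₁ i))

  J₀ : Joins (edge zero) v₀ (node (suc zero))
  J₀ = joins zero

  J∞ : Joins (edge (fromℕ n)) v₀ (node (inject₁ (fromℕ n)))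
  J∞ = turn closed (joins (fromℕ n))

  x≢v₀ : ∀ i → x i ≢ v₀
  x≢v₀ i eq = 0≢1+n (sym (distinct-nodes {suc i} {zero} eq))

  data Role (j : Node) : Set where
    hub      : v₀ ≡ j → Role j
    relay-at : ∀ i → x i ≡ j → Role j
    idle     : Role j

  role : ∀ j → Role j
  role j with v₀ ≟ j | any? (λ i → x i ≟ j)
  ... | yes e | _           = hub e
  ... | no  _ | yes (i , e) = relay-at i e
  ... | no  _ | no _        = idle

  role-hub : role v₀ ≡ hub refl
  role-hub with v₀ ≟ v₀
  ... | yes refl = refl
  ... | no ¬p    = ⊥-elim (¬p refl)

  role-relay : ∀ i → role (x i) ≡ relay-at i refl
  role-relay i with v₀ ≟ x i | any? (λ i′ → x i′ ≟ x i)
  ... | yes e | _ = ⊥-elim (x≢v₀ i (sym e))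
  ... | no  _ | no ¬p = ⊥-elim (¬p (i , refl))
  ... | no  _ | yes (i′ , e) with Fin.suc-injective (distinct-nodes {suc i′} {suc i} e)
  role-relay i | no _ | yes (.i , refl) | refl = refl

  module Embed (k : ℕ) (T : List Transition) (s : ℕ) where

    -- Reduction makes every number a state; on bounded tables it changes nothing and so merges no
    -- states.
    clip : ℕ → Fin (4 + k)
    clip p = p mod (4 + k)

    toℕ-clip : ∀ {p} → p < 4 + k → toℕ (clip p) ≡ p
    toℕ-clip {p} p< = trans (toℕ-fromℕ< (m%n<n p (4 + k))) (m<n⇒m%n≡m p<)

    realize : Transition → Fin (4 + k) × Act v₀ × Fin (4 + k)
    realize (p , o , q) = clip p , perform J₀ J∞ o , clip q

    roleTable : ∀ {j} → Role j → Table (4 + k) j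
    roleTable (hub refl)     = map realize T
    roleTable (relay-at i refl) = relay (joins (inject₁ i)) (joins (suc i))
    roleTable idle           = []

    roleStart : ∀ {j} → Role j → Fin (4 + k)
    roleStart (hub _)     = clip s
    roleStart (relay-at _ _) = zero
    roleStart idle        = zero

    tables : ∀ j → Table (4 + k) j
    tables j = roleTable (role j)

    starts : Node → Fin (4 + k)
    starts j = roleStart (role j)

    ringProtocol : Protocol G
    ringProtocol = protocol (4 + k) tables starts

    target : CompositeState ringProtocol
    target _ = zero

    starts-rest : ∀ j → j ≢ v₀ → starts j ≡ zero
    starts-rest j j≢ with role j
    ... | hub e     = ⊥-elim (j≢ (sym e))
    ... | relay-at _ _ = refl
    ... | idle      = refl

    record Stores (p : ℕ) (w : Word) (S : Node → Fin (4 + k)) (C : Edge → Word) : Set where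
      field
        at-hub  : S v₀ ≡ clip p
        at-rest : ∀ j → j ≢ v₀ → S j ≡ zero
        stored  : C (edge zero) ≡ w
        empty   : ∀ ζ → ζ ≢ edge zero → C ζ ≡ []

    open Stores
    open Reach

    reach-stores : ∀ {p q w w′ S C} → Stores p w S C → (r : Reach (4 + k) tables starts S C v₀ (clip q) (edge zero) w′) →
                   Stores q w′ (S′ r) (C′ r)
    reach-stores I r = record
      { at-hub  = at-node r
      ; at-rest = λ j j≢ → trans (off-node r j j≢) (at-rest I j j≢)
      ; stored  = at-edge r
      ; empty   = λ ζ ζ≢ → trans (off-edge r ζ ζ≢) (empty I ζ ζ≢)
      }

    private
      Eff : ∀ {ξ u v} → Joins ξ u v → Sym → Word → Word → Set
      Eff = Effect (4 + k) tables starts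

    first-port : ∀ {p q a w w′ S C} → Stores p w S C → (clip p , near J₀ a , q) ∈ tables v₀ → Eff J₀ a w w′ →
                 Reach (4 + k) tables starts S C v₀ q (edge zero) w′
    first-port {a = a} {w′ = w′} I t eff =
      act (4 + k) tables starts J₀ t (at-hub I) (subst (λ v → Eff J₀ a v w′) (sym (stored I)) eff)

    last-port : ∀ {p q a w w′ S C} → Stores p w S C → (clip p , near J∞ a , q) ∈ tables v₀ → Eff (swap J₀) a w w′ →
                Reach (4 + k) tables starts S C v₀ q (edge zero) w′
    last-port {a = a} {w′ = w′} I t eff =
      pass tables starts n node edge joins distinct-edges closed x≢v₀
        (λ i {t} → subst (λ r → t ∈ roleTable r) (sym (role-relay i)))
        t (at-hub I) (at-rest I) (λ i → empty I _ (λ eq → 0≢1+n (sym (distinct-edges eq))))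
        (subst (λ v → Eff (swap J₀) a v w′) (sym (stored I)) eff)

    -- If the first edge leaves the hub, writing is direct and reading goes round the cycle; if it
    -- enters the hub, it is the other way round. `put-port` and `get-port` record this split.
    put-port : ∀ {ξ ζ u v v′} (J : Joins ξ u v) (K : Joins ζ u v′) a w →
               (perform J K (put a) ≡ near J a × Eff J a w (w ++ [ a ])) ⊎
               (perform J K (put a) ≡ near K a × Eff (swap J) a w (w ++ [ a ]))
    put-port (inj₁ _) K a w = inj₁ (refl , refl)
    put-port (inj₂ _) K a w = inj₂ (refl , refl)

    get-port : ∀ {ξ ζ u v v′} (J : Joins ξ u v) (K : Joins ζ u v′) a w →
               (perform J K (get a) ≡ near J a × Eff J a (a ∷ w) w) ⊎
               (perform J K (get a) ≡ near K a × Eff (swap J) a (a ∷ w) w)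
    get-port (inj₁ _) K a w = inj₂ (refl , refl)
    get-port (inj₂ _) K a w = inj₁ (refl , refl)

    realize-∈ : ∀ {p o q α} → (p , o , q) ∈ T → perform J₀ J∞ o ≡ α → (clip p , α , clip q) ∈ tables v₀
    realize-∈ {p} {o} {q} t refl = subst (λ r → realize (p , o , q) ∈ roleTable r) (sym role-hub) (∈-map⁺ realize t)

    simulate-step : ∀ {p w q w′ S C} → Stores p w S C → QueueStep T (p , w) (q , w′) →
                    Reach (4 + k) tables starts S C v₀ (clip q) (edge zero) w′
    simulate-step I (put-step {a = a} {w = w} t) with put-port J₀ J∞ a w
    ... | inj₁ (eq , eff) = first-port I (realize-∈ t eq) eff
    ... | inj₂ (eq , eff) = last-port I (realize-∈ t eq) eff
    simulate-step I (get-step {a = a} {w = w} t) with get-port J₀ J∞ a w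
    ... | inj₁ (eq , eff) = first-port I (realize-∈ t eq) eff
    ... | inj₂ (eq , eff) = last-port I (realize-∈ t eq) eff

    simulate : ∀ {p w q w′ S C} → Stores p w S C → Star (QueueStep T) (p , w) (q , w′) →
               ∃[ S₁ ] ∃[ C₁ ] (Star (Step ringProtocol) (S , C) (S₁ , C₁) × Stores q w′ S₁ C₁)
    simulate I ε = _ , _ , ε , I
    simulate I (s ◅ ss) with simulate-step I s
    ... | r with simulate (reach-stores I r) ss
    ...   | S₁ , C₁ , ts , I′ = S₁ , C₁ , steps r ◅◅ ts , I′

    stable⁺ : Star (QueueStep T) (s , []) (0 , []) → Stable ringProtocol target
    stable⁺ ss with simulate start ss
      where
      start : Stores s [] starts (C⁰ ringProtocol)
      start = record
        { at-hub = cong roleStart role-hub ; at-rest = starts-rest ; stored = refl ; empty = λ _ _ → refl }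
    ... | S₁ , C₁ , ts , I = (S₁ , C₁) , ts , all-zero , all-empty
      where
      all-zero : ∀ j → S₁ j ≡ zero
      all-zero j with j ≟ v₀
      ... | yes refl = at-hub I
      ... | no  j≢   = at-rest I j j≢
      all-empty : ∀ ξ → C₁ ξ ≡ []
      all-empty ξ with ξ ≟ edge zero
      ... | yes refl = stored I
      ... | no  ξ≢   = empty I ξ ξ≢

    module _ (bounded : ∀ {p o q} → (p , o , q) ∈ T → p < 4 + k × q < 4 + k) (s-bounded : s < 4 + k) where

      hub-path : ∀ {p w q} → Run (4 + k) (map realize T) p w q →
                 ∃[ ops ] (Path T (toℕ p) ops (toℕ q) × w ≡ map (perform J₀ J∞) ops)
      hub-path [] = [] , [] , refl
      hub-path (t ∷ r) with ∈-map⁻ realize t | hub-path r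
      ... | (p , o , q) , t′ , refl | ops , path , refl =
        o ∷ ops ,
        subst₂ (λ p′ q′ → (p′ , o , q′) ∈ T) (sym (toℕ-clip (proj₁ (bounded t′)))) (sym (toℕ-clip (proj₂ (bounded t′)))) t′ ∷ path ,
        refl

      -- In a stable target the channels are empty and the relays at rest, so words agree across
      -- each edge and through each relay. At the two ports of the hub this becomes the equality of
      -- `puts` and `gets`.
      stable⁻ : Stable ringProtocol target → Accepting T s []
      stable⁻ ((S₁ , C₁) , ss , S₁≈ , C₁≈) with histories (4 + k) tables starts ss
      ... | w , runs , bal with hub-path (subst₂ (λ r q → Run (4 + k) (roleTable r) (roleStart r) (w v₀) q) role-hub (S₁≈ v₀) (runs v₀))
      ...   | ops , path , w₀≡ = ops , subst (λ p → Path T p ops 0) (toℕ-clip s-bounded) path , perform-balanced J₀ J∞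
                (ends-disjoint n node edge joins distinct-edges closed) ops
                (subst (λ v → history J₀ v ≡ history J∞ v) w₀≡ agree)
        where
        across : ∀ ξ → concatMap (sends ξ) (w (tail ξ)) ≡ concatMap (receives ξ) (w (head ξ))
        across ξ = trans (bal ξ) (trans (cong (concatMap (receives ξ) (w (head ξ)) ++_) (C₁≈ ξ)) (++-identityʳ _))
        along : ∀ i → history (swap (joins (inject₁ i))) (w (x i)) ≡ history (joins (suc i)) (w (x i))
        along i = relay-balanced (joins (inject₁ i)) (joins (suc i)) (λ eq → inject₁≢suc i (distinct-edges eq))
          (subst₂ (λ r q → Run (4 + k) (roleTable r) (roleStart r) (w (x i)) q) (role-relay i) (S₁≈ (x i)) (runs (x i)))
          where
          inject₁≢suc : ∀ {n} (i : Fin n) → inject₁ i ≢ suc i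
          inject₁≢suc (suc i) eq = inject₁≢suc i (Fin.suc-injective eq)
        agree : history J₀ (w v₀) ≡ history J∞ (w v₀)
        agree = trans (histories-agree n node edge joins w (λ i → history-across (joins i) w (across (edge i))) along)
                      (history-turn closed (joins (fromℕ n)) w)

-- Computability of the code of the protocol

Computable : ∀ {n} → (Vec ℕ n → ℕ) → Set
Computable {n} F = Σ[ f ∈ Rec n ] (∀ xs → f [ xs ]⇓ F xs)

sucᶜ : ∀ {n} {F : Vec ℕ n → ℕ} → Computable F → Computable (suc ∘ F)
sucᶜ (f , f⇓) = comp sucᵣ (f ∷ []) , λ xs → comp⇓ (f⇓ xs ∷ []) suc⇓

constᶜ : ∀ {n} k → Computable {n} (λ _ → k)
constᶜ zero    = zeroᵣ , λ _ → zero⇓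
constᶜ (suc k) = sucᶜ (constᶜ k)

varᶜ : ∀ {n} (i : Fin n) → Computable (λ xs → lookup xs i)
varᶜ i = proj i , λ _ → proj⇓ i

precᶜ : ∀ {n B H} {F : Vec ℕ (suc n) → ℕ} → Computable B → Computable H →
        (∀ xs → F (0 ∷ xs) ≡ B xs) → (∀ k xs → F (suc k ∷ xs) ≡ H (k ∷ F (k ∷ xs) ∷ xs)) → Computable F
precᶜ {F = F} (b , b⇓) (h , h⇓) F0 Fsuc = prec b h , λ { (k ∷ xs) → eval k xs }
  where
  eval : ∀ k xs → prec b h [ k ∷ xs ]⇓ F (k ∷ xs)
  eval zero    xs = subst (prec b h [ 0 ∷ xs ]⇓_) (sym (F0 xs)) (prec-zero⇓ (b⇓ xs))
  eval (suc k) xs = subst (prec b h [ suc k ∷ xs ]⇓_) (sym (Fsuc k xs)) (prec-suc⇓ (eval k xs) (h⇓ _))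

compose₁ : ∀ {n} {H : ℕ → ℕ} {F : Vec ℕ n → ℕ} → Computable {1} (λ xs → H (lookup xs zero)) →
           Computable F → Computable (λ xs → H (F xs))
compose₁ (h , h⇓) (f , f⇓) = comp h (f ∷ []) , λ xs → comp⇓ (f⇓ xs ∷ []) (h⇓ _)

compose₂ : ∀ {n} {H : ℕ → ℕ → ℕ} {F G : Vec ℕ n → ℕ} → Computable {2} (λ xs → H (lookup xs zero) (lookup xs (suc zero))) →
           Computable F → Computable G → Computable (λ xs → H (F xs) (G xs))
compose₂ (h , h⇓) (f , f⇓) (g , g⇓) = comp h (f ∷ g ∷ []) , λ xs → comp⇓ (f⇓ xs ∷ g⇓ xs ∷ []) (h⇓ _)

+ᶜ : ∀ {n} {F G : Vec ℕ n → ℕ} → Computable F → Computable G → Computable (λ xs → F xs + G xs)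
+ᶜ = compose₂ {H = _+_} (precᶜ (varᶜ zero) (sucᶜ (varᶜ (suc zero))) (λ _ → refl) (λ _ _ → refl))

*ᶜ : ∀ {n} {F G : Vec ℕ n → ℕ} → Computable F → Computable G → Computable (λ xs → F xs * G xs)
*ᶜ = compose₂ {H = _*_} (precᶜ (constᶜ 0) (+ᶜ (varᶜ (suc (suc zero))) (varᶜ (suc zero))) (λ _ → refl) (λ { _ (_ ∷ []) → refl }))

2^ᶜ : ∀ {n} {F : Vec ℕ n → ℕ} → Computable F → Computable (λ xs → 2 ^ F xs)
2^ᶜ = compose₁ {H = 2 ^_} (precᶜ (constᶜ 1) (*ᶜ (constᶜ 2) (varᶜ (suc zero))) (λ _ → refl) (λ _ _ → refl))

⟨_,_⟩ᶜ : ∀ {n} {F G : Vec ℕ n → ℕ} → Computable F → Computable G → Computable (λ xs → ⟨ F xs , G xs ⟩)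
⟨ f , g ⟩ᶜ = *ᶜ (2^ᶜ f) (sucᶜ (*ᶜ (constᶜ 2) g))

[]ᶜ : ∀ {n} → Computable {n} (λ _ → codeList [])
[]ᶜ = constᶜ 0

tabulateᶜ : ∀ {n l} {F : Fin l → Vec ℕ n → ℕ} → (∀ j → Computable (F j)) →
            Computable (λ xs → codeList (tabulate (λ j → F j xs)))
tabulateᶜ {l = zero}  fs = []ᶜ
tabulateᶜ {l = suc l} fs = ⟨ fs zero , tabulateᶜ (fs ∘ suc) ⟩ᶜ

n<2^n : ∀ n → n < 2 ^ n
n<2^n zero    = s≤s z≤n
n<2^n (suc n) = ≤-trans (s≤s (n<2^n n)) (≤-trans (+-monoˡ-≤ (2 ^ n) (m^n>0 2 n))
  (≤-reflexive (cong (2 ^ n +_) (sym (+-identityʳ (2 ^ n))))))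

-- Bounds the states of a program by the code `m` of its table, so that a number of states
-- computable from `m` suffices. A pair code exceeds both components, as `2 ^ a` exceeds `a` and
-- `1 + 2b` exceeds `b`.
∈⇒<codeList : ∀ {x xs} → x ∈ xs → x < codeList xs
∈⇒<codeList {xs = y ∷ xs} (here refl) = ≤-trans (n<2^n y) (m≤m*n (2 ^ y) (suc (2 * codeList xs)))
∈⇒<codeList {xs = y ∷ xs} (there x∈)  = ≤-trans (∈⇒<codeList x∈)
  (≤-trans (≤-trans (m≤n*m (codeList xs) 2) (n≤1+n _)) (m≤n*m (suc (2 * codeList xs)) (2 ^ y) {{m^n≢0 2 y}}))

2*≤⇒<4+2* : ∀ {p q} → p ≤ q → suc (2 * p) < 4 + 2 * q
2*≤⇒<4+2* p≤q = s≤s (s≤s (m≤n⇒m≤1+n (m≤n⇒m≤1+n (*-monoʳ-≤ 2 p≤q))))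

<⇒<4+2* : ∀ {p q} → p < q → p < 4 + 2 * q
<⇒<4+2* {q = q} p<q = ≤-trans p<q (≤-trans (m≤n*m q 2) (m≤n+m (2 * q) 4))

next-bounded : ∀ {k m o q} → k ≤ m → (o , q) ≡ next k → q < 4 + 2 * m
next-bounded {zero}  k≤m refl = s≤s (s≤s (s≤s z≤n))
next-bounded {suc k} k<m refl = 2*≤⇒<4+2* (≤-trans (n≤1+n k) k<m)

input-bounded : ∀ {m T p o q} → (∀ {p o q} → (p , o , q) ∈ T → p < m × q < m) →
                (p , o , q) ∈ input m ++ T → p < 4 + 2 * m × q < 4 + 2 * m
input-bounded {m} T-bounded t with ∈-++⁻ (input m) t
... | inj₁ t′ with ∈-input⁻ m t′
...   | k , k≤ , refl , nx = 2*≤⇒<4+2* k≤ , next-bounded k≤ nx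
input-bounded T-bounded t | inj₂ t′ with T-bounded t′
...   | p< , q< = <⇒<4+2* p< , <⇒<4+2* q<

-- The self-referential instance

module Diagonal (G : DiGraph) (n : ℕ)
  (node : Fin (2 + n) → DiGraph.Node G) (edge : Fin (1 + n) → DiGraph.Edge G)
  (joins : ∀ i → Network.Joins G (edge i) (node (inject₁ i)) (node (suc i)))
  (closed : node (fromℕ (suc n)) ≡ node zero)
  (distinct-nodes : Injective _≡_ _≡_ (node ∘ inject₁))
  (distinct-edges : Injective _≡_ _≡_ edge) where
  open DiGraph G
  open Network G
  open Ring G n node edge joins closed distinct-nodes distinct-edges
  open Ports G

  open DecisionProblem (StableCompositeStateProblem G) using (code; Yes)

  Decides : Rec 1 → Σ (Protocol G) CompositeState → Set
  Decides f x = (Yes x × f [ code x ∷ [] ]⇓ 1) ⊎ (¬ Yes x × f [ code x ∷ [] ]⇓ 0)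

  code₃ : ℕ × ℕ × ℕ → ℕ
  code₃ (p , a , q) = codeList (p ∷ a ∷ q ∷ [])

  symbolic : Transition → ℕ × ℕ × ℕ
  symbolic (p , o , q) = p , codeAction (perform J₀ J∞ o) , q

  codeTransition : Transition → ℕ
  codeTransition = code₃ ∘ symbolic

  numbers : ∀ {N j} → Fin N × Act j × Fin N → ℕ × ℕ × ℕ
  numbers (p , α , q) = toℕ p , codeAction α , toℕ q

  -- A list code is built from its tail, so the input part can be put in front of a program known
  -- only by its code `r`.
  inputCode : ℕ → ℕ → ℕ
  inputCode zero    r = ⟨ codeTransition (1 , next 0) , r ⟩
  inputCode (suc k) r = ⟨ codeTransition (suc (2 * suc k) , next (suc k)) , inputCode k r ⟩

  inputCode-correct : ∀ k T → inputCode k (codeList (map codeTransition T)) ≡ codeList (map codeTransition (input k ++ T))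
  inputCode-correct zero    T = refl
  inputCode-correct (suc k) T = cong ⟨ codeTransition (suc (2 * suc k) , next (suc k)) ,_⟩ (inputCode-correct k T)

  relayCode : Fin n → ℕ
  relayCode i = codeList (map code₃ (map numbers (relay {k = 0} (joins (inject₁ i)) (joins (suc i)))))

  -- A relay uses the states 0 to 3 whatever the padding, so its table has a constant code although
  -- the number of states depends on `m`.
  numbers-relay : ∀ {k ξ ζ u x v} (J : Joins ξ u x) (K : Joins ζ x v) →
                  map numbers (relay {k = k} J K) ≡ map numbers (relay {k = 0} J K)
  numbers-relay J (inj₁ _) = refl
  numbers-relay J (inj₂ _) = refl

  machineCode : ∀ {j} → Role j → ℕ → ℕ
  -- Self-reference enters here: the first `m` is the number to be written, the second the code of
  -- the program.
  machineCode (hub _)        m = codeList (4 + 2 * m ∷ inputCode m m ∷ suc (2 * m) ∷ [])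
  machineCode (relay-at i _) m = codeList (4 + 2 * m ∷ relayCode i ∷ 0 ∷ [])
  machineCode idle           m = codeList (4 + 2 * m ∷ 0 ∷ 0 ∷ [])

  instanceCode : ℕ → ℕ
  instanceCode m = codeList
    ( codeList (codeList (tabulate {n = #edges} (λ _ → 3)) ∷ codeList (tabulate (λ j → machineCode (role j) m)) ∷ [])
    ∷ codeList (tabulate {n = #nodes} (λ _ → 0))
    ∷ [])

  codeTransitionᶜ : ∀ {l o} {P Q : Vec ℕ l → ℕ} → Computable P → Computable Q → Computable (λ xs → codeTransition (P xs , o , Q xs))
  codeTransitionᶜ {o = o} p q = ⟨ p , ⟨ constᶜ (codeAction (perform J₀ J∞ o)) , ⟨ q , []ᶜ ⟩ᶜ ⟩ᶜ ⟩ᶜ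

  inputCodeᶜ : Computable {2} (λ xs → inputCode (lookup xs zero) (lookup xs (suc zero)))
  inputCodeᶜ = precᶜ
    ⟨ constᶜ (codeTransition (1 , next 0)) , varᶜ zero ⟩ᶜ
    ⟨ codeTransitionᶜ (sucᶜ (*ᶜ (constᶜ 2) (sucᶜ (varᶜ zero)))) (sucᶜ (*ᶜ (constᶜ 2) (varᶜ zero))) , varᶜ (suc zero) ⟩ᶜ
    (λ _ → refl) (λ _ _ → refl)

  machineCodeᶜ : ∀ {j} (r : Role j) → Computable {1} (λ xs → machineCode r (lookup xs zero))
  machineCodeᶜ = go
    where
    two : Computable {1} (λ xs → 2 * lookup xs zero)
    two = *ᶜ (constᶜ 2) (varᶜ zero)
    size : Computable {1} (λ xs → 4 + 2 * lookup xs zero)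
    size = sucᶜ (sucᶜ (sucᶜ (sucᶜ two)))
    go : ∀ {j} (r : Role j) → Computable {1} (λ xs → machineCode r (lookup xs zero))
    go (hub _)        = ⟨ size , ⟨ compose₂ {H = inputCode} inputCodeᶜ (varᶜ zero) (varᶜ zero) , ⟨ sucᶜ two , []ᶜ ⟩ᶜ ⟩ᶜ ⟩ᶜ
    go (relay-at i _) = ⟨ size , constᶜ (codeList (relayCode i ∷ 0 ∷ [])) ⟩ᶜ
    go idle           = ⟨ size , constᶜ (codeList (0 ∷ 0 ∷ [])) ⟩ᶜ

  instanceCodeᶜ : Computable {1} (λ xs → instanceCode (lookup xs zero))
  instanceCodeᶜ =
    ⟨ ⟨ constᶜ (codeList (tabulate {n = #edges} (λ _ → 3))) , ⟨ tabulateᶜ (λ j → machineCodeᶜ (role j)) , []ᶜ ⟩ᶜ ⟩ᶜ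
    , ⟨ constᶜ (codeList (tabulate {n = #nodes} (λ _ → 0))) , []ᶜ ⟩ᶜ ⟩ᶜ

  -- The code is a variable with an equation, so the arguments below treat the huge numeral as
  -- opaque.
  module _ (c : Cmd) {m : ℕ} (m≡ : m ≡ codeList (map codeTransition (Machine.program c))) where
    open Machine c
    open Embed (2 * m) (table m) (suc (2 * m))

    program-bounded : ∀ {p o q} → (p , o , q) ∈ program → p < m × q < m
    program-bounded {p} {o} {q} t =
      <-trans (∈⇒<codeList {xs = numerals} (here refl)) t< ,
      <-trans (∈⇒<codeList {xs = numerals} (there (there (here refl)))) t<
      where
      numerals : List ℕ
      numerals = p ∷ codeAction (perform J₀ J∞ o) ∷ q ∷ []
      t< : codeList numerals < m
      t< = subst (codeList numerals <_) (sym m≡) (∈⇒<codeList {xs = map codeTransition program} (∈-map⁺ codeTransition t))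

    table-bounded : ∀ {p o q} → (p , o , q) ∈ table m → p < 4 + 2 * m × q < 4 + 2 * m
    table-bounded = input-bounded program-bounded

    numbers-realize : ∀ T → (∀ {t} → t ∈ T → t ∈ table m) → map numbers (map realize T) ≡ map symbolic T
    numbers-realize []                T⊆ = refl
    numbers-realize ((p , o , q) ∷ T) T⊆ = cong₂ _∷_
      (cong₂ (λ p q → p , codeAction (perform J₀ J∞ o) , q)
        (toℕ-clip (proj₁ (table-bounded (T⊆ (here refl))))) (toℕ-clip (proj₂ (table-bounded (T⊆ (here refl))))))
      (numbers-realize T (T⊆ ∘ there))

    codeMachine : ∀ {j} (r : Role j) →
      codeList (4 + 2 * m ∷ codeList (map code₃ (map numbers (roleTable r))) ∷ toℕ (roleStart r) ∷ []) ≡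
      machineCode r m
    codeMachine (hub refl) = cong₂ (λ a b → codeList (4 + 2 * m ∷ a ∷ b ∷ []))
      (trans
        (cong codeList (trans (cong (map code₃) (numbers-realize (table m) (λ t → t))) (sym (map-∘ (table m)))))
        (sym (trans (cong (inputCode m) m≡) (inputCode-correct m program))))
      (toℕ-clip (2*≤⇒<4+2* {m} ≤-refl))
    codeMachine (relay-at i refl) = cong (λ a → codeList (4 + 2 * m ∷ codeList (map code₃ a) ∷ 0 ∷ []))
      (numbers-relay (joins (inject₁ i)) (joins (suc i)))
    codeMachine idle = refl

    instanceCode-correct :
      code (ringProtocol , target) ≡ instanceCode m
    instanceCode-correct =
      cong (λ F → codeList (codeList (codeList (tabulate {n = #edges} (λ _ → 3)) ∷ codeList F ∷ []) ∷
                            codeList (tabulate {n = #nodes} (λ _ → 0)) ∷ []))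
        (tabulate-cong (λ j → trans
          (cong (λ ts → codeList (4 + 2 * m ∷ codeList ts ∷ toℕ (starts j) ∷ [])) (map-∘ (tables j)))
          (codeMachine (role j))))

    -- The machine computes the verdict on its own instance and contradicts it.
    not-decided : (f : Rec 1) → (∀ {y} → f [ instanceCode m ∷ [] ]⇓ y → c ⊩ [ m ] ⇝ [ y ]) →
                  ¬ Decides f (ringProtocol , target)
    not-decided f computes (inj₁ (stable , f⇓1)) =
      rejects (computes (subst (λ x → f [ x ∷ [] ]⇓ 1) instanceCode-correct f⇓1))
        (stable⁻ table-bounded (2*≤⇒<4+2* {m} ≤-refl) stable)
    not-decided f computes (inj₂ (unstable , f⇓0)) =
      unstable (stable⁺ (accepts (computes (subst (λ x → f [ x ∷ [] ]⇓ 0) instanceCode-correct f⇓0))))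

    no-decider : (f : Rec 1) → (∀ {y} → f [ instanceCode m ∷ [] ]⇓ y → c ⊩ [ m ] ⇝ [ y ]) → ¬ (∀ x → Decides f x)
    no-decider f computes decides = not-decided f computes (decides (ringProtocol , target))

  -- The command does not contain its own code: `m` reaches it as input and is determined only after
  -- the command is fixed. The final `remove 1` discards this input and leaves the verdict alone.
  diagonal : Rec 1 → Cmd
  diagonal f = compile (comp f (proj₁ instanceCodeᶜ ∷ [])) (0 ∷ []) ⨾ remove 1

  diagonal⇝ : ∀ f {m y} → f [ instanceCode m ∷ [] ]⇓ y → diagonal f ⊩ [ m ] ⇝ [ y ]
  diagonal⇝ f {m} {y} f⇓y =
    compile⇝ (comp f (proj₁ instanceCodeᶜ ∷ [])) (comp⇓ (proj₂ instanceCodeᶜ (m ∷ []) ∷ []) f⇓y) (here ∷ []) ⨟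
    remove⇝ [ y ] m []

  undecidable : AlgorithmicallyUndecidable (StableCompositeStateProblem G)
  undecidable (f , decides) = no-decider (diagonal f) refl f (diagonal⇝ f) decides

theorem7p2 : (G : DiGraph) → Cycle (∇ G) → AlgorithmicallyUndecidable (StableCompositeStateProblem G)
-- Length zero is excluded by `positive`; a loop gives `n = 0`, a ring without relays.
theorem7p2 G record { length = suc n ; node = node ; edge = edge ; joins = joins ; closed = closed
                    ; distinct-nodes = distinct-nodes ; distinct-edges = distinct-edges } =
  Diagonal.undecidable G n node edge joins closed distinct-nodes distinct-edges
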